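{- Let $W$ and $R$ be positive integers and let $\epsilon>0$ satisfy $\epsilon^{ -1}\le 2W\left(1-\frac{1}{\log W}\right)$. Set $\upsilon=\lceil\log(\epsilon^{ -1}\log W)\rceil$ and $k=\left\lceil\frac{1}{2\epsilon-2^{ -\upsilon}}\right\rceil$, and assume $\frac Wk$ is an integer. Then Algorithm 2 (described in the context, run with these parameters) provides an $RW\epsilon$-additive approximation for Basic-Summing; that is, for every input stream of integers in $\{0,1,\dots,R\}$ and at every time, the value $\widehat{S}$ returned by Query satisfies $|\widehat{S}-S|\le RW\epsilon$.
   Context: All logarithms are base 2. Basic-Summing: given a stream of integers in $\{0,1,\dots,R\}$ arriving one at a time, maintain the sum $S$ of the last $W$ elements (elements before the beginning of the stream are regarded as 0). For $z\in[0,1]$, $\mathrm{Round}_{\upsilon}(z)$ denotes rounding of $z$ to the nearest value $\widetilde z$ such that $2^{\upsilon}\widetilde z$ is an integer. Algorithm 2. Variables: a fixed-point number $y$, integers $B,i,m$ and a bit array $b=(b_0,\dots,b_{k-1})$, all initialized to $0$. Add(element $x$): first set $x'=\mathrm{Round}_{\upsilon}\left(\frac xR\right)$. If $m=\frac Wk-1$, then do in order: (1) $B\leftarrow B-b_i$; (2) if $y+x'\ge\frac Wk$, set $b_i\leftarrow1$ and $y\leftarrow y-\frac Wk+x'$; otherwise set $b_i\leftarrow0$ and $y\leftarrow y+x'$; (3) $B\leftarrow B+b_i$; (4) $m\leftarrow0$; (5) $i\leftarrow i+1\bmod k$. Otherwise (if $m\ne\frac Wk-1$): $y\leftarrow y+x'$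 and $m\leftarrow m+1$. Query: return $R\cdot\left(\frac Wk\cdot B+y-\frac W{2k}-m\cdot b_i\right)$. Each arriving stream element is processed by one call of Add.
   Formalization: W ≥ 2 is assumed (so 1/log W is defined), and Round may break ties arbitrarily except that its values must be at most 1; this matters only for υ = −1, where rounding z = 1 up to 2 makes the claim false (e.g. W = 4, ε = 4, constant stream R). -}

module Defs where

open import Algebra.Bundles using (CommutativeRing)
open import Data.Bool using (Bool; true; false)
open import Data.Empty using (⊥; ⊥-elim)
open import Data.Fin using (Fin; toℕ)
open import Data.Integer as ℤ using (ℤ; +_; -[1+_])
import Data.Integer.Properties as ℤP
import Data.Integer.Tactic.RingSolver as ℤSolver
open import Data.Nat as ℕ using (ℕ; zero; suc; NonZero; NonTrivial)
import Data.Nat.Properties as ℕP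
open import Data.Nat.DivMod using (_mod_)
open import Data.Product using (∃; Σ; _×_; _,_; proj₁; proj₂)
open import Data.Rational
  using (ℚ; mkℚ; 0ℚ; 1ℚ; ½; _+_; _*_; _-_; -_; _/_; 1/_; ∣_∣; _≤_; _<_;
         positive; nonNegative; toℚᵘ; >-nonZero)
open import Data.Rational.Properties as ℚP
import Data.Rational.Unnormalised as ℚᵘ
import Data.Rational.Unnormalised.Properties as ℚᵘP
open import Data.Sum using (_⊎_; inj₁; inj₂; [_,_]′; map; swap)
open import Data.Vec using (Vec; lookup; replicate; _[_]≔_)
open import Relation.Binary.PropositionalEquality
open import Relation.Nullary using (Dec; yes; no)
open import Relation.Nullary.Decidable using (dec⇒maybe; from-yes)
open import Tactic.RingSolver using (solve-∀)
open import Tactic.RingSolver.Core.AlmostCommutativeRing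
  using (AlmostCommutativeRing; fromCommutativeRing)
open import Algebra.Properties.CommutativeSemiring.Exp
  (CommutativeRing.commutativeSemiring +-*-commutativeRing)
  using (_^_; ^-homo-*; ^-assocʳ; ^-distrib-*)

fromℤ : ℤ → ℚ
fromℤ i = i / 1

fromℕ : ℕ → ℚ
fromℕ n = fromℤ (+ n)

2ℚ : ℚ
2ℚ = fromℕ 2

2^_ : ℤ → ℚ
2^ (+ n)    = 2ℚ ^ n
2^ -[1+ n ] = ½ ^ suc n

module ℚ-Lemmas where
  ring : AlmostCommutativeRing _ _
  ring = fromCommutativeRing +-*-commutativeRing (λ x → dec⇒maybe (0ℚ ≟ x))

  diff< : ∀ {p q} → p < q → 0ℚ < q - p
  diff< {p} {q} h = subst (_< q - p) (+-inverseʳ p) (+-monoˡ-< (- p) h)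

  diff≤ : ∀ {p q} → p ≤ q → 0ℚ ≤ q - p
  diff≤ {p} {q} h = subst (_≤ q - p) (+-inverseʳ p) (+-monoˡ-≤ (- p) h)

  cancel-diff : ∀ p q → (q - p) + p ≡ q
  cancel-diff = solve-∀ ring

  by< : ∀ {p q e} → 0ℚ < e → e ≡ q - p → p < q
  by< {p} {q} h refl =
    subst₂ _<_ (+-identityˡ p) (cancel-diff p q) (+-monoˡ-< p h)

  by≤ : ∀ {p q e} → 0ℚ ≤ e → e ≡ q - p → p ≤ q
  by≤ {p} {q} h refl =
    subst₂ _≤_ (+-identityˡ p) (cancel-diff p q) (+-monoˡ-≤ p h)

  0<+ : ∀ {p q} → 0ℚ < p → 0ℚ < q → 0ℚ < p + q
  0<+ = +-mono-<

  0<* : ∀ {p q} → 0ℚ < p → 0ℚ < q → 0ℚ < p * q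
  0<* {p} {q} hp hq =
    positive⁻¹ (p * q) {{pos*pos⇒pos p {{positive hp}} q {{positive hq}}}}

  0≤* : ∀ {p q} → 0ℚ ≤ p → 0ℚ ≤ q → 0ℚ ≤ p * q
  0≤* {p} {q} hp hq =
    nonNegative⁻¹ (p * q)
      {{nonNeg*nonNeg⇒nonNeg p {{nonNegative hp}} q {{nonNegative hq}}}}

  *-monoˡ : ∀ {r p q} → 0ℚ ≤ r → p ≤ q → r * p ≤ r * q
  *-monoˡ {r} h pq = *-monoˡ-≤-nonNeg r {{nonNegative h}} pq

  *-mono : ∀ {p q r s} → 0ℚ ≤ p → 0ℚ ≤ r → p ≤ q → r ≤ s → p * r ≤ q * s
  *-mono {p} {q} {r} {s} 0≤p 0≤r pq rs =
    ≤-trans (*-monoˡ 0≤p rs)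
      (*-monoʳ-≤-nonNeg s {{nonNegative (≤-trans 0≤r rs)}} pq)

  *-monoˡ-< : ∀ {r p q} → 0ℚ < r → p < q → r * p < r * q
  *-monoˡ-< {r} h pq = *-monoʳ-<-pos r {{positive h}} pq

  *-cancel-< : ∀ {r p q} → 0ℚ < r → r * p < r * q → p < q
  *-cancel-< {r} h = *-cancelˡ-<-nonNeg r {{nonNegative (<⇒≤ h)}}

  *-cancel-≤ : ∀ {r p q} → 0ℚ < r → r * p ≤ r * q → p ≤ q
  *-cancel-≤ {r} h = *-cancelˡ-≤-pos r {{positive h}}

  0<1 : 0ℚ < 1ℚ
  0<1 = positive⁻¹ 1ℚ

  0<½ : 0ℚ < ½
  0<½ = positive⁻¹ ½

  0<2 : 0ℚ < 2ℚ
  0<2 = positive⁻¹ 2ℚ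

  recip : ∀ {p} → 0ℚ < p → ∃ λ r → 0ℚ < r × p * r ≡ 1ℚ
  recip {p} h =
    (1/ p) {{>-nonZero h}} ,
    positive⁻¹ _ {{1/pos⇒pos p {{positive h}}}} ,
    *-inverseʳ p {{>-nonZero h}}

  toℚᵘ-/ : ∀ i n → toℚᵘ (i / suc n) ℚᵘ.≃ ℚᵘ.mkℚᵘ i n
  toℚᵘ-/ i n = toℚᵘ-fromℚᵘ (ℚᵘ.mkℚᵘ i n)

  /-≤ : ∀ i m j n → i ℤ.* + suc n ℤ.≤ j ℤ.* + suc m → i / suc m ≤ j / suc n
  /-≤ i m j n h = toℚᵘ-cancel-≤
    (ℚᵘP.≤-respˡ-≃ (ℚᵘP.≃-sym (toℚᵘ-/ i m))
      (ℚᵘP.≤-respʳ-≃ (ℚᵘP.≃-sym (toℚᵘ-/ j n)) (ℚᵘ.*≤* h)))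

  /-< : ∀ i m j n → i ℤ.* + suc n ℤ.< j ℤ.* + suc m → i / suc m < j / suc n
  /-< i m j n h = toℚᵘ-cancel-<
    (ℚᵘP.<-respˡ-≃ (ℚᵘP.≃-sym (toℚᵘ-/ i m))
      (ℚᵘP.<-respʳ-≃ (ℚᵘP.≃-sym (toℚᵘ-/ j n)) (ℚᵘ.*<* h)))

  fromℤ-+ : ∀ i j → fromℤ (i ℤ.+ j) ≡ fromℤ i + fromℤ j
  fromℤ-+ i j = toℚᵘ-injective (ℚᵘP.≃-trans (toℚᵘ-/ (i ℤ.+ j) 0)
    (ℚᵘP.≃-sym (ℚᵘP.≃-trans (toℚᵘ-homo-+ (fromℤ i) (fromℤ j))
      (ℚᵘP.≃-trans (ℚᵘP.+-cong (toℚᵘ-/ i 0) (toℚᵘ-/ j 0))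
        (ℚᵘ.*≡* (eq i j))))))
    where
    eq : ∀ i j → (i ℤ.* + 1 ℤ.+ j ℤ.* + 1) ℤ.* + 1 ≡ (i ℤ.+ j) ℤ.* + 1
    eq = ℤSolver.solve-∀

  0≤fromℕ : ∀ n → 0ℚ ≤ fromℕ n
  0≤fromℕ n = /-≤ (+ 0) 0 (+ n) 0
    (subst (+ 0 ℤ.≤_) (sym (ℤP.*-identityʳ (+ n))) (ℤ.+≤+ ℕ.z≤n))

  0<fromℕ-suc : ∀ n → 0ℚ < fromℕ (suc n)
  0<fromℕ-suc n = positive⁻¹ _ {{ℚP.normalize-pos (suc n) 1}}

  archimedean : ∀ p → ∃ λ n → p ≤ fromℕ n
  archimedean p@(mkℚ i d-1 _) = ℤ.∣ i ∣ , toℚᵘ-cancel-≤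
    (ℚᵘP.≤-respʳ-≃ (ℚᵘP.≃-sym (toℚᵘ-/ (+ ℤ.∣ i ∣) 0)) (ℚᵘ.*≤* (lemma i)))
    where
    lemma : ∀ i → i ℤ.* + 1 ℤ.≤ + ℤ.∣ i ∣ ℤ.* + suc d-1
    lemma (+ n) = ℤP.*-monoˡ-≤-nonNeg (+ n) (ℤ.+≤+ (ℕ.s≤s ℕ.z≤n))
    lemma -[1+ n ] = ℤ.-≤+

  archimedean* : ∀ w {η} → 0ℚ < η → ∃ λ n → w ≤ fromℕ n * η
  archimedean* w {η} 0<η with recip 0<η
  ... | r , _ , ηr≡1 with archimedean (w * r)
  ...   | n , h = n , subst (_≤ fromℕ n * η) eq
                        (*-monoʳ-≤-nonNeg η {{nonNegative (<⇒≤ 0<η)}} h)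
    where
    eq : (w * r) * η ≡ w
    eq = trans (assoc w r η) (trans (cong (w *_) ηr≡1) (*-identityʳ w))
      where
      assoc : ∀ w r η → (w * r) * η ≡ w * (η * r)
      assoc = solve-∀ ring

  0<^ : ∀ {p} → 0ℚ < p → ∀ n → 0ℚ < p ^ n
  0<^ h zero    = 0<1
  0<^ h (suc n) = 0<* h (0<^ h n)

  ^-mono : ∀ {p q} → 0ℚ < p → p ≤ q → ∀ n → p ^ n ≤ q ^ n
  ^-mono h pq zero    = ≤-refl
  ^-mono h pq (suc n) = *-mono (<⇒≤ h) (<⇒≤ (0<^ h n)) pq (^-mono h pq n)

  0<2^ : ∀ i → 0ℚ < 2^ i
  0<2^ (+ n)    = 0<^ 0<2 n
  0<2^ -[1+ n ] = 0<^ 0<½ (suc n)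

  2^-suc : ∀ i → 2^ (ℤ.suc i) ≡ 2ℚ * 2^ i
  2^-suc (+ n)          = refl
  2^-suc -[1+ zero ]    = refl
  2^-suc -[1+ (suc n) ] = sym (eq (½ ^ suc n))
    where
    eq : ∀ x → 2ℚ * (½ * x) ≡ x
    eq = solve-∀ ring

  2^-neg : ∀ n → 2^ (ℤ.- (+ n)) ≡ ½ ^ n
  2^-neg zero    = refl
  2^-neg (suc n) = refl

  2^-inverse : ∀ i → 2^ i * 2^ (ℤ.- i) ≡ 1ℚ
  2^-inverse (+ n) = trans (cong (2ℚ ^ n *_) (2^-neg n)) (lemma n)
    where
    step : ∀ x y → (2ℚ * x) * (½ * y) ≡ x * y
    step = solve-∀ ring
    lemma : ∀ n → 2ℚ ^ n * ½ ^ n ≡ 1ℚ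
    lemma zero    = refl
    lemma (suc n) = trans (step (2ℚ ^ n) (½ ^ n)) (lemma n)
  2^-inverse -[1+ n ] =
    trans (*-comm (½ ^ suc n) (2ℚ ^ suc n))
      (2^-inverse (+ suc n))

  2^-* : ∀ i n → (2^ i) ^ n ≡ 2^ (i ℤ.* + n)
  2^-* (+ m) n = trans (^-assocʳ 2ℚ m n) (cong 2^_ (ℤP.pos-* m n))
  2^-* -[1+ m ] n = trans (^-assocʳ ½ (suc m) n)
    (trans (sym (2^-neg (suc m ℕ.* n))) (cong 2^_ eq))
    where
    eq : ℤ.- (+ (suc m ℕ.* n)) ≡ -[1+ m ] ℤ.* + n
    eq = trans (cong ℤ.-_ (ℤP.pos-* (suc m) n))
           (ℤP.neg-distribˡ-* (+ suc m) (+ n))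

  2^-step : ∀ i → 2^ i < 2^ (ℤ.suc i)
  2^-step i = by< (0<2^ i) (trans (eq (2^ i)) (cong (_- 2^ i) (sym (2^-suc i))))
    where
    eq : ∀ x → x ≡ 2ℚ * x - x
    eq = solve-∀ ring

  2^-mono-+ : ∀ i n → 2^ i ≤ 2^ (+ n ℤ.+ i)
  2^-mono-+ i zero    = ≤-reflexive (cong 2^_ (sym (ℤP.+-identityˡ i)))
  2^-mono-+ i (suc n) = ≤-trans (2^-mono-+ i n)
    (≤-trans (<⇒≤ (2^-step (+ n ℤ.+ i)))
      (≤-reflexive (cong 2^_ (eq (+ n) i))))
    where
    eq : ∀ n i → + 1 ℤ.+ (n ℤ.+ i) ≡ (+ 1 ℤ.+ n) ℤ.+ i
    eq = ℤSolver.solve-∀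

  2^-mono-≤ : ∀ {i j} → i ℤ.≤ j → 2^ i ≤ 2^ j
  2^-mono-≤ {i} {j} h with j ℤ.- i in eq | ℤP.i≤j⇒0≤j-i h
  ... | + n | _ = ≤-trans (2^-mono-+ i n)
    (≤-reflexive (cong 2^_ (trans (cong (ℤ._+ i) (sym eq)) (cancel i j))))
    where
    cancel : ∀ i j → (j ℤ.- i) ℤ.+ i ≡ j
    cancel = ℤSolver.solve-∀

  2^-mono-< : ∀ {i j} → i ℤ.< j → 2^ i < 2^ j
  2^-mono-< {i} h = <-≤-trans (2^-step i) (2^-mono-≤ (ℤP.i<j⇒suc[i]≤j h))

  n≤2^n : ∀ n → fromℕ n ≤ 2^ (+ n)
  n≤2^n zero    = <⇒≤ 0<1
  n≤2^n (suc n) = ≤-trans (≤-reflexive (fromℤ-+ (+ 1) (+ n)))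
    (by≤ (+-mono-≤ (diff≤ (1≤2^ n)) (diff≤ (n≤2^n n)))
      (eq (2ℚ ^ n) (fromℕ n)))
    where
    1≤2^ : ∀ n → 1ℚ ≤ 2ℚ ^ n
    1≤2^ n = 2^-mono-≤ {+ 0} {+ n} (ℤ.+≤+ ℕ.z≤n)
    eq : ∀ x y → (x - 1ℚ) + (x - y) ≡ 2ℚ * x - (1ℚ + y)
    eq = solve-∀ ring

  bernoulli : ∀ {t} → 0ℚ ≤ t → t ≤ 1ℚ → ∀ n →
              1ℚ - fromℕ n * t ≤ (1ℚ - t) ^ n
  bernoulli {t} 0≤t t≤1 zero = ≤-reflexive (eq t)
    where
    eq : ∀ t → 1ℚ - 0ℚ * t ≡ 1ℚ
    eq = solve-∀ ring
  bernoulli {t} 0≤t t≤1 (suc n) = ≤-trans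
    (by≤ (0≤* (0≤fromℕ n) (0≤* 0≤t 0≤t))
      (trans (eq (fromℕ n) t)
        (cong (λ x → (1ℚ - t) * (1ℚ - fromℕ n * t) - (1ℚ - x * t))
          (sym (fromℤ-+ (+ 1) (+ n))))))
    (*-monoˡ (diff≤ t≤1) (bernoulli 0≤t t≤1 n))
    where
    eq : ∀ n t → n * (t * t) ≡ (1ℚ - t) * (1ℚ - n * t) - (1ℚ - (1ℚ + n) * t)
    eq = solve-∀ ring

  root-½ : ∀ n → ∃ λ s → 0ℚ < s × s < 1ℚ × ½ ≤ s ^ suc n
  root-½ n =
    let t , 0<t , 2ct≡1 = recip (0<* 0<2 (0<fromℕ-suc n)) in
    shrink (fromℕ (suc n)) (0≤fromℕ n) (fromℤ-+ (+ 1) (+ n)) 0<t 2ct≡1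
      (λ 0≤t t≤1 → bernoulli 0≤t t≤1 (suc n))
    where
    eq₁ : ∀ t → t ≡ 1ℚ - (1ℚ - t)
    eq₁ = solve-∀ ring
    eq₂ : ∀ n t → n * t ≡ ½ * ((2ℚ * n) * t)
    eq₂ = solve-∀ ring
    eq₃ : ∀ n t → n * t ≡ (1ℚ + n) * t - t
    eq₃ = solve-∀ ring
    shrink : ∀ c {b t} → 0ℚ ≤ b → c ≡ 1ℚ + b → 0ℚ < t → (2ℚ * c) * t ≡ 1ℚ →
             (0ℚ ≤ t → t ≤ 1ℚ → 1ℚ - c * t ≤ (1ℚ - t) ^ suc n) →
             ∃ λ s → 0ℚ < s × s < 1ℚ × ½ ≤ s ^ suc n
    shrink c {b} {t} 0≤b c≡ 0<t 2ct≡1 bern =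
      1ℚ - t , diff< (≤-<-trans t≤½ ½<1) , by< 0<t (eq₁ t) ,
      subst (λ z → 1ℚ - z ≤ (1ℚ - t) ^ suc n) half
        (bern (<⇒≤ 0<t) (≤-trans t≤½ (<⇒≤ ½<1)))
      where
      half : c * t ≡ ½
      half = trans (eq₂ c t) (cong (½ *_) 2ct≡1)
      ½<1 : ½ < 1ℚ
      ½<1 = by< 0<½ refl
      t≤½ : t ≤ ½
      t≤½ = by≤ (0≤* 0≤b (<⇒≤ 0<t)) (trans (eq₃ b t)
        (trans (cong (λ z → z * t - t) (sym c≡)) (cong (_- t) half)))

  unit : ∀ {e} z → e ≡ 1ℚ → e * z ≡ z
  unit z refl = *-identityˡ z

  undo : ∀ c {r} → c * r ≡ 1ℚ → ∀ p → p ≡ c * (r * p)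
  undo c {r} cr≡1 p = trans (sym (unit p cr≡1)) (*-assoc c r p)

open ℚ-Lemmas

-- Located two-sided Dedekind cuts:  L p  means  p < x  and  U q  means  x < q .
record ℝ : Set₁ where
  field
    L U         : ℚ → Set
    L-inhabited : ∃ L
    U-inhabited : ∃ U
    L-down      : ∀ {p q} → p < q → L q → L p
    U-up        : ∀ {p q} → p < q → U p → U q
    L-open      : ∀ {p} → L p → ∃ λ q → p < q × L q
    U-open      : ∀ {q} → U q → ∃ λ p → p < q × U p
    disjoint    : ∀ {p q} → L p → U q → p < q
    located     : ∀ {p q} → p < q → L p ⊎ U q

open ℝ

infix 4 _<ℝ_ _≤ℝ_

_<ℝ_ : ℝ → ℝ → Set
x <ℝ y = ∃ λ q → U x q × L y q

_≤ℝ_ : ℝ → ℝ → Set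
x ≤ℝ y = ∀ {p} → L x p → L y p

-- The real number  sup l = inf u ; neither l nor u need be closed or open.
cut : (l u : ℚ → Set) → ∃ l → ∃ u →
      (∀ {p q} → l p → u q → p ≤ q) →
      (∀ {p q} → p < q →
        (∃ λ p′ → p ≤ p′ × l p′) ⊎ (∃ λ q′ → q′ ≤ q × u q′)) →
      ℝ
cut l u (p₀ , lp₀) (q₀ , uq₀) disj loc = record
  { L           = λ p → ∃ λ p′ → p < p′ × l p′
  ; U           = λ q → ∃ λ q′ → q′ < q × u q′
  ; L-inhabited = p₀ - 1ℚ , p₀ , by< 0<1 (eq₁ p₀) , lp₀
  ; U-inhabited = q₀ + 1ℚ , q₀ , by< 0<1 (eq₂ q₀) , uq₀
  ; L-down      = λ { p<q (q′ , q<q′ , l) → q′ , <-trans p<q q<q′ , l }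
  ; U-up        = λ { p<q (p′ , p′<p , u) → p′ , <-trans p′<p p<q , u }
  ; L-open      = λ { (p′ , p<p′ , l) → let m , p<m , m<p′ = <-dense p<p′ in
                      m , p<m , p′ , m<p′ , l }
  ; U-open      = λ { (q′ , q′<q , u) → let m , q′<m , m<q = <-dense q′<q in
                      m , m<q , q′ , q′<m , u }
  ; disjoint    = λ { (p′ , p<p′ , l) (q′ , q′<q , u) →
                      <-trans p<p′ (≤-<-trans (disj l u) q′<q) }
  ; located     = λ p<q →
      let m , p<m , m<q = <-dense p<q
          n , m<n , n<q = <-dense m<q
      in widen p<m n<q (loc m<n)
  }
  where
  eq₁ : ∀ p → 1ℚ ≡ p - (p - 1ℚ)
  eq₁ = solve-∀ ring
  eq₂ : ∀ q → 1ℚ ≡ (q + 1ℚ) - q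
  eq₂ = solve-∀ ring
  widen : ∀ {p m n q} → p < m → n < q →
          (∃ λ p′ → m ≤ p′ × l p′) ⊎ (∃ λ q′ → q′ ≤ n × u q′) →
          (∃ λ p′ → p < p′ × l p′) ⊎ (∃ λ q′ → q′ < q × u q′)
  widen p<m n<q (inj₁ (p′ , m≤p′ , lp′)) = inj₁ (p′ , <-≤-trans p<m m≤p′ , lp′)
  widen p<m n<q (inj₂ (q′ , q′≤n , uq′)) = inj₂ (q′ , ≤-<-trans q′≤n n<q , uq′)

private
  exact : ∀ {l u : ℚ → Set} {p q} → l p ⊎ u q →
          (∃ λ p′ → p ≤ p′ × l p′) ⊎ (∃ λ q′ → q′ ≤ q × u q′)
  exact = map (λ lp → _ , ≤-refl , lp) (λ uq → _ , ≤-refl , uq)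

fromℚ : ℚ → ℝ
fromℚ c = cut (_≤ c) (c ≤_) (c , ≤-refl) (c , ≤-refl) ≤-trans loc
  where
  loc : ∀ {p q} → p < q →
        (∃ λ p′ → p ≤ p′ × p′ ≤ c) ⊎ (∃ λ q′ → q′ ≤ q × c ≤ q′)
  loc {p} {q} p<q with ≤-total p c
  ... | inj₁ p≤c = inj₁ (p , ≤-refl , p≤c)
  ... | inj₂ c≤p = inj₂ (p , <⇒≤ p<q , c≤p)

0ℝ 1ℝ : ℝ
0ℝ = fromℚ 0ℚ
1ℝ = fromℚ 1ℚ

module ℝ-Lemmas where
  L⇒<ℝ : ∀ x {c} → L x c → fromℚ c <ℝ x
  L⇒<ℝ x {c} Lc = let q , c<q , Lq = L-open x Lc in q , (c , c<q , ≤-refl) , Lq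

  <ℝ⇒L : ∀ x {c} → fromℚ c <ℝ x → L x c
  <ℝ⇒L x (q , (q′ , q′<q , c≤q′) , Lq) = L-down x (≤-<-trans c≤q′ q′<q) Lq

  approximate : ∀ x {c δ} → L x c → 0ℚ < δ →
                ∃ λ a → c ≤ a × L x a × U x (a + δ)
  approximate x {c₀} {δ} Lc₀ 0<δ =
    let d , Ud = U-inhabited x
        n , h  = archimedean* (d - c₀) 0<η
    in walk n c₀ Lc₀ Ud ≤-refl
         (by≤ (diff≤ h) (eq₀ (fromℕ n * η) d c₀))
    where
    η = ½ * δ
    0<η : 0ℚ < η
    0<η = 0<* 0<½ 0<δ
    eq₀ : ∀ z d c → z - (d - c) ≡ (c + z) - d
    eq₀ = solve-∀ ring
    eq₁ : ∀ c e → e ≡ (c + e) - c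
    eq₁ = solve-∀ ring
    eq₂ : ∀ c δ → ½ * δ ≡ ((c + ½ * δ) + ½ * δ) - (c + ½ * δ)
    eq₂ = solve-∀ ring
    eq₃ : ∀ c δ → (c + ½ * δ) + ½ * δ ≡ c + δ
    eq₃ = solve-∀ ring
    eq₄ : ∀ c e n → c + (1ℚ + n) * e ≡ (c + e) + n * e
    eq₄ = solve-∀ ring
    eq₅ : ∀ c e → c + 0ℚ * e ≡ c
    eq₅ = solve-∀ ring
    walk : ∀ n c {d} → L x c → U x d → c₀ ≤ c → d ≤ c + fromℕ n * η →
           ∃ λ a → c₀ ≤ a × L x a × U x (a + δ)
    walk zero c {d} Lc Ud c₀≤c d≤ = ⊥-elim (<-irrefl refl
      (<-≤-trans (disjoint x Lc Ud) (≤-trans d≤ (≤-reflexive (eq₅ c η)))))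
    walk (suc n) c {d} Lc Ud c₀≤c d≤ =
      [ (λ L′ → walk n (c + η) L′ Ud
          (≤-trans c₀≤c (by≤ (<⇒≤ 0<η) (eq₁ c η)))
          (≤-trans d≤ (≤-reflexive (trans
            (cong (λ z → c + z * η) (fromℤ-+ (+ 1) (+ n)))
            (eq₄ c η (fromℕ n))))))
      , (λ U′ → c , c₀≤c , Lc , subst (U x) (eq₃ c δ) U′)
      ]′ (located x {c + η} {(c + η) + η} (by< 0<η (eq₂ c δ)))

  -- Two-sided approximation of a positive real within a factor q / p.
  approximate* : ∀ x {p q} → 0ℝ <ℝ x → 0ℚ < p → p < q →
                 ∃ λ a → ∃ λ d → 0ℚ < a × L x a × U x d × p * d < q * a
  approximate* x {p} {q} 0<x 0<p p<q =
    let c , 0<c , Lc = L-open x (<ℝ⇒L x 0<x)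
        m , p<m , m<q = <-dense p<q
        r , 0<r , pr≡1 = recip 0<p
        a , c≤a , La , Ua = approximate x Lc
                              (0<* (0<* (diff< p<m) 0<c) 0<r)
        0<a = <-≤-trans 0<c c≤a
    in a , a + ((m - p) * c) * r , 0<a , La , Ua ,
       by< (+-mono-<-≤ (0<* (diff< m<q) 0<a)
             (0≤* (<⇒≤ (diff< p<m)) (diff≤ c≤a)))
           (trans (eq p q m a c) (cong (λ z → q * a - z) (sym (expand p m a c r pr≡1))))
    where
    eq : ∀ p q m a c → (q - m) * a + (m - p) * (a - c)
         ≡ q * a - (p * a + (m - p) * c)
    eq = solve-∀ ring
    expand₁ : ∀ p m a c r → p * (a + ((m - p) * c) * r)
              ≡ p * a + ((m - p) * c) * (p * r)
    expand₁ = solve-∀ ring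
    expand : ∀ p m a c r → p * r ≡ 1ℚ →
             p * (a + ((m - p) * c) * r) ≡ p * a + (m - p) * c
    expand p m a c r h = trans (expand₁ p m a c r)
      (trans (cong (λ z → p * a + ((m - p) * c) * z) h)
        (cong (λ z → p * a + z) (*-identityʳ ((m - p) * c))))

open ℝ-Lemmas

infixl 6 _+ℝ_ _-ℝ_
infix  8 -ℝ_

-ℝ_ : ℝ → ℝ
-ℝ x = record
  { L           = λ p → U x (- p)
  ; U           = λ q → L x (- q)
  ; L-inhabited = let q , Uq = U-inhabited x in - q , subst (U x) (sym (inv q)) Uq
  ; U-inhabited = let p , Lp = L-inhabited x in - p , subst (L x) (sym (inv p)) Lp
  ; L-down      = λ p<q → U-up x (neg-antimono-< p<q)
  ; U-up        = λ p<q → L-down x (neg-antimono-< p<q)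
  ; L-open      = λ {p} h → let q , q<-p , Uq = U-open x h in
                    - q , subst (_< - q) (inv p) (neg-antimono-< q<-p) ,
                    subst (U x) (sym (inv q)) Uq
  ; U-open      = λ {q} h → let p , -q<p , Lp = L-open x h in
                    - p , subst (- p <_) (inv q) (neg-antimono-< -q<p) ,
                    subst (L x) (sym (inv p)) Lp
  ; disjoint    = λ {p} {q} Up Lq →
                    subst₂ _<_ (inv p) (inv q) (neg-antimono-< (disjoint x Lq Up))
  ; located     = λ {p} {q} p<q → swap (located x (neg-antimono-< p<q))
  }
  where
  inv : ∀ p → - - p ≡ p
  inv = solve-∀ ring

_+ℝ_ : ℝ → ℝ → ℝ
x +ℝ y = cut l u
  (let a , La = L-inhabited x ; b , Lb = L-inhabited y in
   a + b , a , b , La , Lb , refl)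
  (let c , Uc = U-inhabited x ; d , Ud = U-inhabited y in
   c + d , c , d , Uc , Ud , refl)
  (λ { (a , b , La , Lb , refl) (c , d , Uc , Ud , refl) →
       +-mono-≤ {a} {c} {b} {d} (<⇒≤ (disjoint x La Uc)) (<⇒≤ (disjoint y Lb Ud)) })
  loc
  where
  l = λ p → ∃ λ a → ∃ λ b → L x a × L y b × p ≡ a + b
  u = λ q → ∃ λ c → ∃ λ d → U x c × U y d × q ≡ c + d
  halve : ∀ p q a → ½ * (q - p) ≡ (q - (a + ½ * (q - p))) - (p - a)
  halve = solve-∀ ring
  restore : ∀ p a → p ≡ a + (p - a)
  restore = solve-∀ ring
  l-intro : ∀ {p a} → L x a → L y (p - a) → l p
  l-intro {p} {a} La Lb = a , p - a , La , Lb , restore p a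
  u-intro : ∀ {q c} → U x c → U y (q - c) → u q
  u-intro {q} {c} Uc Ud = c , q - c , Uc , Ud , restore q c
  gap : ∀ {p q} a → p < q → p - a < q - (a + ½ * (q - p))
  gap {p} {q} a p<q = by< (0<* 0<½ (diff< p<q)) (halve p q a)
  loc : ∀ {p q} → p < q →
    (∃ λ p′ → p ≤ p′ × l p′) ⊎ (∃ λ q′ → q′ ≤ q × u q′)
  loc {p} {q} p<q =
    let a , _ , La , Uc = approximate x (proj₂ (L-inhabited x))
                            (0<* 0<½ (diff< p<q))
    in [ (λ Lb → inj₁ (p , ≤-refl , l-intro La Lb))
       , (λ Ud → inj₂ (q , ≤-refl , u-intro Uc Ud))
       ]′ (located y (gap a p<q))

_-ℝ_ : ℝ → ℝ → ℝ
x -ℝ y = x +ℝ (-ℝ y)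

scale : (c : ℚ) → 0ℚ < c → ℝ → ℝ
scale c 0<c x = cut l u
  (let a , La = L-inhabited x in c * a , a , La , refl)
  (let d , Ud = U-inhabited x in c * d , d , Ud , refl)
  (λ { (a , La , refl) (d , Ud , refl) →
       *-monoˡ {c} {a} {d} (<⇒≤ 0<c) (<⇒≤ (disjoint x La Ud)) })
  loc
  where
  l = λ p → ∃ λ a → L x a × p ≡ c * a
  u = λ q → ∃ λ d → U x d × q ≡ c * d
  l-intro : ∀ {p r} → c * r ≡ 1ℚ → L x (r * p) → l p
  l-intro {p} {r} cr≡1 La = r * p , La , undo c cr≡1 p
  u-intro : ∀ {q r} → c * r ≡ 1ℚ → U x (r * q) → u q
  u-intro {q} {r} cr≡1 Ud = r * q , Ud , undo c cr≡1 q
  loc : ∀ {p q} → p < q →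
    (∃ λ p′ → p ≤ p′ × l p′) ⊎ (∃ λ q′ → q′ ≤ q × u q′)
  loc {p} {q} p<q =
    let r , 0<r , cr≡1 = recip 0<c
    in [ (λ La → inj₁ (p , ≤-refl , l-intro {p} {r} cr≡1 La))
       , (λ Ud → inj₂ (q , ≤-refl , u-intro {q} {r} cr≡1 Ud))
       ]′ (located x (*-monoˡ-< {r} {p} {q} 0<r p<q))

infixr 7 _·_

_·_ : (n : ℕ) .{{_ : NonZero n}} → ℝ → ℝ
n@(suc n-1) · x = scale (fromℕ n) (0<fromℕ-suc n-1) x

ℝ⁺ : Set₁
ℝ⁺ = Σ ℝ (0ℝ <ℝ_)

toℝ : ℝ⁺ → ℝ
toℝ = proj₁

module ℝ⁺-Lemmas where
  U⇒0< : ∀ (x : ℝ⁺) {q} → U (toℝ x) q → 0ℚ < q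
  U⇒0< (x , 0<x) Uq = disjoint x (<ℝ⇒L x 0<x) Uq

open ℝ⁺-Lemmas

infixl 7 _*⁺_
infix  9 _⁻¹

_*⁺_ : ℝ⁺ → ℝ⁺ → ℝ⁺
x⁺@(x , 0<x) *⁺ y⁺@(y , 0<y) = z , L⇒<ℝ z 0∈z
  where
  l = λ p → ∃ λ a → ∃ λ b → 0ℚ < a × 0ℚ < b × L x a × L y b × p ≡ a * b
  u = λ q → ∃ λ c → ∃ λ d → U x c × U y d × q ≡ c * d
  l-intro : ∀ {p a r} → 0ℚ < a → 0ℚ < r → 0ℚ < p → a * r ≡ 1ℚ →
            L x a → L y (r * p) → l p
  l-intro {p} {a} {r} 0<a 0<r 0<p ar≡1 La Lb =
    a , r * p , 0<a , 0<* 0<r 0<p , La , Lb , undo a ar≡1 p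
  u-intro : ∀ {q d t} → d * t ≡ 1ℚ → U x d → U y (t * q) → u q
  u-intro {q} {d} {t} dt≡1 Ud Ue = d , t * q , Ud , Ue , undo d dt≡1 q
  someL : ∃ λ p → 0ℚ < p × l p
  someL =
    let a , 0<a , La = L-open x (<ℝ⇒L x 0<x)
        b , 0<b , Lb = L-open y (<ℝ⇒L y 0<y)
    in a * b , 0<* 0<a 0<b , a , b , 0<a , 0<b , La , Lb , refl
  regroup₁ : ∀ a d r p → (a * r) * (p * d) ≡ (a * d) * (r * p)
  regroup₁ = solve-∀ ring
  regroup₂ : ∀ a d t q → (d * t) * (q * a) ≡ (a * d) * (t * q)
  regroup₂ = solve-∀ ring
  rescale : ∀ {p q a d r t} → 0ℚ < a → 0ℚ < d → a * r ≡ 1ℚ → d * t ≡ 1ℚ →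
            p * d < q * a → r * p < t * q
  rescale {p} {q} {a} {d} {r} {t} 0<a 0<d ar≡1 dt≡1 pd<qa =
    *-cancel-< {a * d} {r * p} {t * q} (0<* 0<a 0<d)
      (subst₂ _<_ (trans (sym (unit (p * d) ar≡1)) (regroup₁ a d r p))
                  (trans (sym (unit (q * a) dt≡1)) (regroup₂ a d t q)) pd<qa)
  separate : ∀ {p q a d} → 0ℚ < p → 0ℚ < a → 0ℚ < d →
    L x a → U x d → p * d < q * a →
    (∃ λ r → 0ℚ < r × a * r ≡ 1ℚ) → (∃ λ t → 0ℚ < t × d * t ≡ 1ℚ) → l p ⊎ u q
  separate {p} {q} {a} {d} 0<p 0<a 0<d La Ud pd<qa
           (r , 0<r , ar≡1) (t , _ , dt≡1) =
    [ (λ Lb → inj₁ (l-intro {p} {a} {r} 0<a 0<r 0<p ar≡1 La Lb))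
    , (λ Ue → inj₂ (u-intro {q} {d} {t} dt≡1 Ud Ue))
    ]′ (located y (rescale {p} {q} {a} {d} {r} {t} 0<a 0<d ar≡1 dt≡1 pd<qa))
  loc⁺ : ∀ {p q} → 0ℚ < p → p < q → l p ⊎ u q
  loc⁺ {p} {q} 0<p p<q =
    let a , d , 0<a , La , Ud , pd<qa = approximate* x 0<x 0<p p<q
        0<d = U⇒0< x⁺ Ud
    in separate {p} {q} {a} {d} 0<p 0<a 0<d La Ud pd<qa (recip 0<a) (recip 0<d)
  loc : ∀ {p q} → p < q →
    (∃ λ p′ → p ≤ p′ × l p′) ⊎ (∃ λ q′ → q′ ≤ q × u q′)
  loc {p} {q} p<q with 0ℚ <? p
  ... | yes 0<p = exact (loc⁺ 0<p p<q)
  ... | no ¬0<p = let p′ , 0<p′ , lp′ = someL in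
                  inj₁ (p′ , ≤-trans (≮⇒≥ ¬0<p) (<⇒≤ 0<p′) , lp′)
  z : ℝ
  z = cut l u
    (let p , _ , lp = someL in p , lp)
    (let c , Uc = U-inhabited x ; d , Ud = U-inhabited y in
     c * d , c , d , Uc , Ud , refl)
    (λ { (a , b , 0<a , 0<b , La , Lb , refl) (c , d , Uc , Ud , refl) →
         *-mono {a} {c} {b} {d} (<⇒≤ 0<a) (<⇒≤ 0<b)
           (<⇒≤ (disjoint x La Uc)) (<⇒≤ (disjoint y Lb Ud)) })
    loc
  0∈z : L z 0ℚ
  0∈z = someL

_⁻¹ : ℝ⁺ → ℝ⁺
x⁺@(x , 0<x) ⁻¹ = z , L⇒<ℝ z 0∈z
  where
  l = λ p → ∃ λ c → U x c × p * c ≤ 1ℚ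
  u = λ q → ∃ λ a → 0ℚ < a × L x a × 1ℚ ≤ q * a
  someL : ∃ λ p → 0ℚ < p × l p
  someL =
    let c , Uc = U-inhabited x
        r , 0<r , cr≡1 = recip (U⇒0< x⁺ Uc)
    in r , 0<r , c , Uc , ≤-reflexive (trans (*-comm r c) cr≡1)
  someU : ∃ u
  someU =
    let a , 0<a , La = L-open x (<ℝ⇒L x 0<x)
        r , _ , ar≡1 = recip 0<a
    in r , a , 0<a , La , ≤-reflexive (sym (trans (*-comm r a) ar≡1))
  disj : ∀ {p q} → l p → u q → p ≤ q
  disj {p} {q} (c , Uc , pc≤1) (a , 0<a , La , 1≤qa) with 0ℚ <? q
  ... | yes 0<q = *-cancel-≤ (U⇒0< x⁺ Uc)
        (≤-trans (subst (_≤ 1ℚ) (*-comm p c) pc≤1)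
          (≤-trans 1≤qa (subst (q * a ≤_) (*-comm q c)
            (*-monoˡ (<⇒≤ 0<q) (<⇒≤ (disjoint x La Uc))))))
  ... | no ¬0<q = ⊥-elim (<-irrefl refl (<-≤-trans 0<1 (≤-trans 1≤qa
        (subst (q * a ≤_) (*-zeroˡ a)
          (*-monoʳ-≤-nonNeg a {{nonNegative (<⇒≤ 0<a)}} (≮⇒≥ ¬0<q))))))
  regroup₁ : ∀ p q t → (q * t) * p ≡ (p * q) * t
  regroup₁ = solve-∀ ring
  regroup₂ : ∀ p q r → (p * r) * q ≡ (p * q) * r
  regroup₂ = solve-∀ ring
  invert : ∀ {p q r t} → 0ℚ < p → 0ℚ < q → p * r ≡ 1ℚ → q * t ≡ 1ℚ →
           p < q → t < r
  invert {p} {q} {r} {t} 0<p 0<q pr≡1 qt≡1 p<q =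
    *-cancel-< {p * q} {t} {r} (0<* 0<p 0<q)
      (subst₂ _<_ (trans (sym (unit p qt≡1)) (regroup₁ p q t))
                  (trans (sym (unit q pr≡1)) (regroup₂ p q r)) p<q)
  loc⁺ : ∀ {p q} → 0ℚ < p → p < q → l p ⊎ u q
  loc⁺ {p} {q} 0<p p<q =
    let 0<q = <-trans 0<p p<q
        r , 0<r , pr≡1 = recip 0<p
        t , 0<t , qt≡1 = recip 0<q
    in [ (λ Lt → inj₂ (t , 0<t , Lt , ≤-reflexive (sym qt≡1)))
       , (λ Ur → inj₁ (r , Ur , ≤-reflexive pr≡1))
       ]′ (located x (invert {p} {q} {r} {t} 0<p 0<q pr≡1 qt≡1 p<q))
  loc : ∀ {p q} → p < q →
    (∃ λ p′ → p ≤ p′ × l p′) ⊎ (∃ λ q′ → q′ ≤ q × u q′)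
  loc {p} {q} p<q with 0ℚ <? p
  ... | yes 0<p = exact (loc⁺ 0<p p<q)
  ... | no ¬0<p = let p′ , 0<p′ , lp′ = someL in
                  inj₁ (p′ , ≤-trans (≮⇒≥ ¬0<p) (<⇒≤ 0<p′) , lp′)
  z : ℝ
  z = cut l u (let p , _ , lp = someL in p , lp) someU disj loc
  0∈z : L z 0ℚ
  0∈z = someL

private
  log-≤ : ∀ m n m′ n′ {c d} → 0ℚ < c → c ≤ d →
          2^ m ≤ c ^ suc n → d ^ suc n′ ≤ 2^ m′ → m / suc n ≤ m′ / suc n′
  log-≤ m n m′ n′ {c} {d} 0<c c≤d 2^m≤ ≤2^m′ =
    decide (m ℤ.* + suc n′ ℤP.≤? m′ ℤ.* + suc n)
    where
    lower : (2^ m) ^ suc n′ ≤ (c ^ suc n) ^ suc n′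
    lower = ^-mono (0<2^ m) 2^m≤ (suc n′)
    middle : (c ^ suc n) ^ suc n′ ≤ (d ^ suc n) ^ suc n′
    middle = ^-mono (0<^ 0<c (suc n)) (^-mono 0<c c≤d (suc n)) (suc n′)
    swap-^ : (d ^ suc n) ^ suc n′ ≡ (d ^ suc n′) ^ suc n
    swap-^ = trans (^-assocʳ d (suc n) (suc n′))
      (trans (cong (d ^_) (ℕP.*-comm (suc n) (suc n′)))
        (sym (^-assocʳ d (suc n′) (suc n))))
    upper : (d ^ suc n′) ^ suc n ≤ (2^ m′) ^ suc n
    upper = ^-mono (0<^ (<-≤-trans 0<c c≤d) (suc n′)) ≤2^m′ (suc n)
    chain : 2^ (m ℤ.* + suc n′) ≤ 2^ (m′ ℤ.* + suc n)
    chain = subst₂ _≤_ (2^-* m (suc n′)) (2^-* m′ (suc n))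
      (≤-trans lower (≤-trans middle (≤-trans (≤-reflexive swap-^) upper)))
    decide : Dec (m ℤ.* + suc n′ ℤ.≤ m′ ℤ.* + suc n) → m / suc n ≤ m′ / suc n′
    decide (yes h) = /-≤ m n m′ n′ h
    decide (no ¬h) =
      ⊥-elim (<-irrefl refl (<-≤-trans (2^-mono-< (ℤP.≰⇒> ¬h)) chain))

  above : ∀ m n {r a d} → 0ℚ < r → 0ℚ < d → ½ ≤ r ^ suc n → r * d < 1ℚ * a →
          a ^ suc n ≤ 2^ m → d ^ suc n ≤ 2^ (ℤ.suc m)
  above m n {r} {a} {d} 0<r 0<d ½≤ rd<a a≤ =
    subst₂ _≤_ (sym (double (d ^ suc n))) (sym (2^-suc m))
      (*-monoˡ (<⇒≤ 0<2) (≤-trans halved (≤-trans product a≤)))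
    where
    double : ∀ z → z ≡ 2ℚ * (½ * z)
    double = solve-∀ ring
    halved : ½ * d ^ suc n ≤ r ^ suc n * d ^ suc n
    halved = *-monoʳ-≤-nonNeg (d ^ suc n)
      {{nonNegative (<⇒≤ (0<^ 0<d (suc n)))}} ½≤
    rd≤a : r * d ≤ a
    rd≤a = subst (r * d ≤_) (*-identityˡ a) (<⇒≤ rd<a)
    product : r ^ suc n * d ^ suc n ≤ a ^ suc n
    product = subst (_≤ a ^ suc n) (^-distrib-* r d (suc n))
      (^-mono (0<* 0<r 0<d) rd≤a (suc n))

  common-denominator : ∀ {p q} → p < q → ∃ λ m → ∃ λ n →
                       p ≤ m / suc n × ℤ.suc m / suc n ≤ q
  common-denominator {p@(mkℚ a b-1 _)} {q@(mkℚ c d-1 _)} p<q = m , n , p≤ , ≤q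
    where
    m = a ℤ.* + suc d-1
    n = d-1 ℕ.+ b-1 ℕ.* suc d-1
    eq₁ : ∀ a b d → a ℤ.* (b ℤ.* d) ≡ (a ℤ.* d) ℤ.* b
    eq₁ = ℤSolver.solve-∀
    eq₂ : ∀ c b d → (c ℤ.* b) ℤ.* d ≡ c ℤ.* (b ℤ.* d)
    eq₂ = ℤSolver.solve-∀
    p≤ : p ≤ m / suc n
    p≤ = toℚᵘ-cancel-≤ (ℚᵘP.≤-respʳ-≃ (ℚᵘP.≃-sym (toℚᵘ-/ m n))
      (ℚᵘ.*≤* (ℤP.≤-reflexive (trans
        (cong (a ℤ.*_) (ℤP.pos-* (suc b-1) (suc d-1)))
        (eq₁ a (+ suc b-1) (+ suc d-1))))))
    ≤q : ℤ.suc m / suc n ≤ q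
    ≤q = toℚᵘ-cancel-≤ (ℚᵘP.≤-respˡ-≃ (ℚᵘP.≃-sym (toℚᵘ-/ (ℤ.suc m) n))
      (ℚᵘ.*≤* (ℤP.≤-trans
        (ℤP.*-monoʳ-≤-nonNeg (+ suc d-1) (ℤP.i<j⇒suc[i]≤j (drop-*<* p<q)))
        (ℤP.≤-reflexive (trans (eq₂ c (+ suc b-1) (+ suc d-1))
          (cong (c ℤ.*_) (sym (ℤP.pos-* (suc b-1) (suc d-1)))))))))

  2^-below : ∀ {c} → 0ℚ < c → ∃ λ m → 2^ m ≤ c ^ 1
  2^-below {c} 0<c = bound (recip 0<c)
    where
    eq : ∀ c z → c * z ≡ z * (c * 1ℚ)
    eq = solve-∀ ring
    bound : (∃ λ r → 0ℚ < r × c * r ≡ 1ℚ) → ∃ λ m → 2^ m ≤ c ^ 1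
    bound (r , _ , cr≡1) = scaled (archimedean r)
      where
      scaled : (∃ λ n → r ≤ fromℕ n) → ∃ λ m → 2^ m ≤ c ^ 1
      scaled (n , r≤n) = ℤ.- (+ n) ,
        *-cancel-≤ {2^ (+ n)} {2^ (ℤ.- (+ n))} {c ^ 1} (0<2^ (+ n))
          (subst₂ _≤_ (trans cr≡1 (sym (2^-inverse (+ n)))) (eq c (2^ (+ n)))
            (*-monoˡ {c} {r} {2^ (+ n)} (<⇒≤ 0<c) (≤-trans r≤n (n≤2^n n))))

  2^-above : ∀ d → ∃ λ m → d ^ 1 ≤ 2^ m
  2^-above d = bound (archimedean d)
    where
    bound : (∃ λ n → d ≤ fromℕ n) → ∃ λ m → d ^ 1 ≤ 2^ m
    bound (n , d≤n) =
      + n , subst (_≤ 2^ (+ n)) (sym (*-identityʳ d)) (≤-trans d≤n (n≤2^n n))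

-- Base-2 logarithm:  log x = sup { m/n : 2ᵐ ≤ xⁿ } = inf { m/n : xⁿ ≤ 2ᵐ } ,
-- with xⁿ bounded through rationals below and above x.
log : ℝ⁺ → ℝ
log x⁺@(x , 0<x) = cut l u someL someU disj loc
  where
  l = λ p → ∃ λ m → ∃ λ n → ∃ λ c →
        0ℚ < c × L x c × 2^ m ≤ c ^ suc n × p ≡ m / suc n
  u = λ q → ∃ λ m → ∃ λ n → ∃ λ d →
        U x d × d ^ suc n ≤ 2^ m × q ≡ m / suc n
  l-intro : ∀ m n {c} → 0ℚ < c → L x c → 2^ m ≤ c ^ suc n → l (m / suc n)
  l-intro m n {c} 0<c Lc h = m , n , c , 0<c , Lc , h , refl
  u-intro : ∀ m n {d} → U x d → d ^ suc n ≤ 2^ m → u (m / suc n)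
  u-intro m n {d} Ud h = m , n , d , Ud , h , refl
  someL : ∃ l
  someL =
    let c , 0<c , Lc = L-open x (<ℝ⇒L x 0<x)
        m , h = 2^-below 0<c
    in m / 1 , l-intro m 0 0<c Lc h
  someU : ∃ u
  someU =
    let d , Ud = U-inhabited x
        m , h = 2^-above d
    in m / 1 , u-intro m 0 Ud h
  disj : ∀ {p q} → l p → u q → p ≤ q
  disj (m , n , c , 0<c , Lc , 2^m≤ , refl) (m′ , n′ , d , Ud , ≤2^m′ , refl) =
    log-≤ m n m′ n′ 0<c (<⇒≤ (disjoint x Lc Ud)) 2^m≤ ≤2^m′
  compare : ∀ m n {r a d} → 0ℚ < r → ½ ≤ r ^ suc n → 0ℚ < a →
            L x a → U x d → r * d < 1ℚ * a → l (m / suc n) ⊎ u (ℤ.suc m / suc n)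
  compare m n {r} {a} {d} 0<r ½≤ 0<a La Ud rd<a =
    [ (λ h → inj₁ (l-intro m n 0<a La h))
    , (λ h → inj₂ (u-intro (ℤ.suc m) n Ud
                     (above m n {r} {a} {d} 0<r (U⇒0< x⁺ Ud) ½≤ rd<a h)))
    ]′ (≤-total (2^ m) (a ^ suc n))
  decide : ∀ m n → l (m / suc n) ⊎ u (ℤ.suc m / suc n)
  decide m n =
    let r , 0<r , r<1 , ½≤ = root-½ n
        a , d , 0<a , La , Ud , rd<a = approximate* x 0<x 0<r r<1
    in compare m n {r} {a} {d} 0<r ½≤ 0<a La Ud rd<a
  loc : ∀ {p q} → p < q →
    (∃ λ p′ → p ≤ p′ × l p′) ⊎ (∃ λ q′ → q′ ≤ q × u q′)
  loc p<q =
    let m , n , p≤ , ≤q = common-denominator p<q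
    in map (λ lp → m / suc n , p≤ , lp) (λ uq → ℤ.suc m / suc n , ≤q , uq)
         (decide m n)

private
  2≤fromℕ : ∀ n → .{{NonTrivial n}} → 2ℚ ≤ fromℕ n
  2≤fromℕ n = /-≤ (+ 2) 0 (+ n) 0
    (ℤP.*-monoʳ-≤-nonNeg (+ 1) (ℤ.+≤+ (ℕ.nonTrivial⇒n>1 n)))

fromℕ⁺ : (n : ℕ) .{{_ : NonTrivial n}} → ℝ⁺
fromℕ⁺ n = fromℚ (fromℕ n) ,
  L⇒<ℝ (fromℚ (fromℕ n)) (2ℚ , 0<2 , 2≤fromℕ n)

private
  7/4 3/4 7/10 : ℚ
  7/4  = + 7 / 4
  3/4  = + 3 / 4
  7/10 = + 7 / 10

  L-log : ∀ n .{{_ : NonTrivial n}} {p} → p < 3/4 → L (log (fromℕ⁺ n)) p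
  L-log n p<3/4 = 3/4 , p<3/4 , + 3 , 3 , 7/4 , from-yes (0ℚ <? 7/4) ,
    (2ℚ , from-yes (7/4 <? 2ℚ) , 2≤fromℕ n) ,
    from-yes (2^ (+ 3) ≤? 7/4 ^ 4) , refl

log⁺ : (n : ℕ) .{{_ : NonTrivial n}} → ℝ⁺
log⁺ n = log (fromℕ⁺ n) ,
  L⇒<ℝ (log (fromℕ⁺ n)) (L-log n (from-yes (0ℚ <? 3/4)))

infix 4 ⌈_⌉≡_

⌈_⌉≡_ : ℝ → ℤ → Set
⌈ x ⌉≡ n = fromℚ (fromℤ (n ℤ.- + 1)) <ℝ x × x ≤ℝ fromℚ (fromℤ n)

private
  9/5 6/5 20/11 : ℚ
  9/5   = + 9 / 5
  6/5   = + 6 / 5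
  20/11 = + 20 / 11

  10ℚ 11ℚ : ℚ
  10ℚ = fromℕ 10
  11ℚ = fromℕ 11

  scale-< : ∀ {a b} P → 0ℚ < P → a < b → a * P < b * P
  scale-< P 0<P a<b = *-monoˡ-<-pos P {{positive 0<P}} a<b

  reciprocal-bound : ∀ {P t a d} → 0ℚ < P → P * t ≡ 1ℚ →
                     10ℚ * d < 11ℚ * a → 2ℚ * a ≤ t → (20/11 * P) * d ≤ 1ℚ
  reciprocal-bound {P} {t} {a} {d} 0<P Pt≡1 10d<11a 2a≤t =
    subst ((20/11 * P) * d ≤_) Pt≡1
      (by≤ (0≤* (<⇒≤ 0<P) (+-mono-≤ (0≤* 0≤2/11 (diff≤ (<⇒≤ 10d<11a))) (diff≤ 2a≤t)))
           (eq P t a d))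
    where
    0≤2/11 : 0ℚ ≤ + 2 / 11
    0≤2/11 = from-yes (0ℚ ≤? + 2 / 11)
    eq : ∀ P t a d → P * ((+ 2 / 11) * (11ℚ * a - 10ℚ * d) + (t - 2ℚ * a))
         ≡ P * t - (20/11 * P) * d
    eq = solve-∀ ring

  fourth-power : ∀ υ → 2^ (ℤ.suc (υ ℤ.* + 4)) ≤ (6/5 * 2^ υ) ^ 4
  fourth-power υ = subst₂ _≤_
    (trans (cong (2ℚ *_) (2^-* υ 4)) (sym (2^-suc (υ ℤ.* + 4))))
    (sym (^-distrib-* 6/5 (2^ υ) 4))
    (*-monoʳ-≤-nonNeg ((2^ υ) ^ 4) {{nonNegative (<⇒≤ (0<^ (0<2^ υ) 4))}}
      (from-yes (2ℚ ≤? 6/5 ^ 4)))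

  υ<[4υ+1]/4 : ∀ υ → fromℤ υ < ℤ.suc (υ ℤ.* + 4) / 4
  υ<[4υ+1]/4 υ = /-< υ 0 (ℤ.suc (υ ℤ.* + 4)) 3
    (subst (υ ℤ.* + 4 ℤ.<_) (sym (ℤP.*-identityʳ _)) (ℤP.suc[i]≤j⇒i<j ℤP.≤-refl))

  ε-large : ∀ (ε ℓ : ℝ⁺) υ → L (toℝ ℓ) 7/10 →
            log (ε ⁻¹ *⁺ ℓ) ≤ℝ fromℚ (fromℤ υ) →
            ∃ λ e → L (toℝ ε) e × 2^ (ℤ.- υ) < 2ℚ * e
  ε-large ε⁺@(ε , 0<ε) ℓ⁺@(ℓ , _) υ Lℓ log≤υ =
    from (approximate* ε {10ℚ} {11ℚ} 0<ε
      (from-yes (0ℚ <? 10ℚ)) (from-yes (10ℚ <? 11ℚ)))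
    where
    P = 2^ υ
    0<P : 0ℚ < P
    0<P = 0<2^ υ
    L-inverse : ∀ {d} → U ε d → (20/11 * P) * d ≤ 1ℚ → L (toℝ (ε⁺ ⁻¹)) (9/5 * P)
    L-inverse {d} Ud h =
      20/11 * P , scale-< P 0<P (from-yes (9/5 <? 20/11)) , d , Ud , h
    split : ∀ P → (9/5 * 7/10) * P ≡ (9/5 * P) * 7/10
    split = solve-∀ ring
    L-product : L (toℝ (ε⁺ ⁻¹)) (9/5 * P) → L (toℝ (ε⁺ ⁻¹ *⁺ ℓ⁺)) (6/5 * P)
    L-product h = (9/5 * P) * 7/10 ,
      subst (6/5 * P <_) (split P)
        (scale-< P 0<P (from-yes (6/5 <? 9/5 * 7/10))) ,
      9/5 * P , 7/10 , 0<* (from-yes (0ℚ <? 9/5)) 0<P , from-yes (0ℚ <? 7/10) ,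
      h , Lℓ , refl
    L-υ : L (toℝ (ε⁺ ⁻¹ *⁺ ℓ⁺)) (6/5 * P) → L (log (ε⁺ ⁻¹ *⁺ ℓ⁺)) (fromℤ υ)
    L-υ h = ℤ.suc (υ ℤ.* + 4) / 4 , υ<[4υ+1]/4 υ ,
      ℤ.suc (υ ℤ.* + 4) , 3 , 6/5 * P ,
      0<* (from-yes (0ℚ <? 6/5)) 0<P , h , fourth-power υ , refl
    υ∉L : ∀ {q} → L (fromℚ q) q → ⊥
    υ∉L (_ , q<p , p≤q) = <-irrefl refl (<-≤-trans q<p p≤q)
    from : (∃ λ a → ∃ λ d → 0ℚ < a × L ε a × U ε d × 10ℚ * d < 11ℚ * a) →
           ∃ λ e → L ε e × 2^ (ℤ.- υ) < 2ℚ * e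
    from (a , d , 0<a , La , Ud , 10d<11a) = decide (2^ (ℤ.- υ) <? 2ℚ * a)
      where
      decide : Dec (2^ (ℤ.- υ) < 2ℚ * a) → ∃ λ e → L ε e × 2^ (ℤ.- υ) < 2ℚ * e
      decide (yes h) = a , La , h
      decide (no ¬h) = ⊥-elim (υ∉L (log≤υ (L-υ (L-product (L-inverse Ud
        (reciprocal-bound {P} {2^ (ℤ.- υ)} {a} {d} 0<P (2^-inverse υ) 10d<11a (≮⇒≥ ¬h)))))))

  difference-positive : ∀ x {e} t → L x e → t < 2ℚ * e →
                        0ℝ <ℝ (2 · x) -ℝ fromℚ t
  difference-positive x {e} t Le t<2e = between (<-dense t<2e)
    where
    inv : ∀ p → - - p ≡ p
    inv = solve-∀ ring
    between : (∃ λ m → t < m × m < 2ℚ * e) → 0ℝ <ℝ (2 · x) -ℝ fromℚ t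
    between (m , t<m , m<2e) = between′ (<-dense m<2e)
      where
      between′ : (∃ λ n → m < n × n < 2ℚ * e) → 0ℝ <ℝ (2 · x) -ℝ fromℚ t
      between′ (n , m<n , n<2e) = L⇒<ℝ ((2 · x) -ℝ fromℚ t)
        (n - m , diff< m<n , n , - m , (2ℚ * e , n<2e , e , Le , refl) ,
         (t , subst (t <_) (sym (inv m)) t<m , ≤-refl) , refl)

-- The denominator 2ε − 2^(−υ); it is positive because υ ≥ log (ε⁻¹ log W).
denominator : (W : ℕ) .{{_ : NonTrivial W}} (ε : ℝ⁺) (υ : ℤ) →
              ⌈ log (ε ⁻¹ *⁺ log⁺ W) ⌉≡ υ → ℝ⁺
denominator W ε υ (_ , log≤υ) =
  2 · toℝ ε -ℝ fromℚ (2^ (ℤ.- υ)) ,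
  (let e , Le , h = ε-large ε (log⁺ W) υ
                      (L-log W (from-yes (7/10 <? 3/4))) log≤υ
   in difference-positive (toℝ ε) (2^ (ℤ.- υ)) Le h)

OnGrid : ℤ → ℚ → Set
OnGrid υ w = ∃ λ n → 2^ υ * w ≡ fromℤ n

-- Ties may be broken either way.  The last field excludes only one thing: for
-- υ = -1 the grid is 2ℤ, which has 0 and 2 equally near to z = 1, and then 0
-- has to be chosen.  For every other υ it follows from the first two fields.
record IsNearest (υ : ℤ) (z z̃ : ℚ) : Set where
  field
    on-grid : OnGrid υ z̃
    nearest : ∀ w → OnGrid υ w → ∣ z - z̃ ∣ ≤ ∣ z - w ∣
    z̃≤1     : z̃ ≤ 1ℚ

IsRound : ℤ → (ℚ → ℚ) → Set
IsRound υ round = ∀ z → 0ℚ ≤ z → z ≤ 1ℚ → IsNearest υ z (round z)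

-- The element with index t arrives at time t + 1.
Stream : ℕ → Set
Stream R = ℕ → Fin (suc R)

-- Sum of the last w of the first t elements, with 0 before the beginning.
lastSum : ∀ {R} → Stream R → (w t : ℕ) → ℕ
lastSum s zero    t       = 0
lastSum s (suc w) zero    = 0
lastSum s (suc w) (suc t) = toℕ (s t) ℕ.+ lastSum s w t

module Algorithm (W k R : ℕ) .{{_ : NonZero k}} .{{_ : NonZero R}}
                 (round : ℚ → ℚ) where

  -- Natural number division, which is exact when k ∣ W.
  block : ℕ
  block = W ℕ./ k

  record State : Set where
    field
      y : ℚ
      B : ℤ
      i : Fin k
      m : ℕ
      b : Vec Bool k

    bᵢ : Bool
    bᵢ = lookup b i

  open State

  bit : Bool → ℤ
  bit false = + 0
  bit true  = + 1

  initial : State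
  initial = record { y = 0ℚ ; B = + 0 ; i = 0 mod k ; m = 0 ; b = replicate k false }

  endBlock : State → Bool → ℚ → State
  endBlock st β y′ = record
    { y = y′
    ; B = (B st ℤ.- bit (bᵢ st)) ℤ.+ bit β
    ; i = suc (toℕ (i st)) mod k
    ; m = 0
    ; b = b st [ i st ]≔ β
    }

  add : State → Fin (suc R) → State
  add st x with m st ℕ.≟ block ℕ.∸ 1 | fromℕ block ≤? y st + round (+ toℕ x / R)
  ... | yes _ | yes _ = endBlock st true (y st - fromℕ block + round (+ toℕ x / R))
  ... | yes _ | no _  = endBlock st false (y st + round (+ toℕ x / R))
  ... | no _  | _     =
    record st { y = y st + round (+ toℕ x / R) ; m = suc (m st) }

  query : State → ℚ
  query st = fromℕ R *
    (fromℕ block * fromℤ (B st) + y st - (+ W / (2 ℕ.* k)) {{ℕP.m*n≢0 2 k}}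
      - fromℕ (m st) * fromℤ (bit (bᵢ st)))

  run : Stream R → ℕ → State
  run s zero    = initial
  run s (suc t) = add (run s t) (s t)

{-# OPTIONS --safe #-}
module Submission where

-- Put N = W / k and let x j be the rounding of s j / R.  The real number ε
-- enters only through one inequality: since k is at least 1 / (2ε - g) with
-- g = 2^(-υ), the rational number (1/k + g) / 2 is at most ε (⁻¹-bound and
-- half-sum-bound).  So it suffices to bound the error of a query, divided by R,
-- by N/2 + W g/2 = W (1/k + g) / 2 (query-error).
--
-- Rounding moves each element by at most g/2, hence the sum over a window by at
-- most W g/2 (lastSum-approx).  The remaining N/2 comes from forgetting most of
-- the rounded stream.  Shift time by W, so that the stream is preceded by k
-- blocks of zeros, and let X be the prefix sums of the shifted stream.  The bit
-- β q of block q records whether the pending amount has reached N at the end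
-- of the block, in which case N is carried; C q counts the carries of the first
-- q blocks.  The invariant of the algorithm in block q, at offset m, is that y
-- is the present prefix sum minus N C (k + q), that B = C (k + q) - C q, and
-- that the array holds the bits of the blocks q, ..., k + q - 1 at their residues
-- modulo k (run-invariant).
-- As X t for t = q N + m is the sum of all that has left the window, a query,
-- divided by R, differs from the rounded window sum by
--     X t - N C q - N/2 - m (β q) .
-- Here X (q N) - N C q lies in [0, N) (Y-bounds).  If β q = 0, then at the end
-- of the block the pending amount is still below N, so X t - N C q is in [0, N);
-- if β q = 1, it is at least N at the end, and at most N - m is added in the
-- remaining N - m steps, so X t - N C q lies in [m, N + m).  In both cases the
-- difference is at most N/2 in absolute value (window-bound).

open import Defs
open import Data.Integer using (ℤ; +_)
open import Data.Nat using (ℕ; NonZero; NonTrivial)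
open import Data.Nat.Divisibility using (_∣_)
open import Data.Rational using (ℚ; _-_; ∣_∣)

open import Data.Bool using (Bool; true; false)
open import Data.Empty using (⊥-elim)
open import Data.Fin using (toℕ)
import Data.Fin.Properties as FinP
import Data.Integer as ℤ
import Data.Integer.Properties as ℤP
import Data.Integer.Tactic.RingSolver as ℤSolver
open import Data.Nat as ℕ using (zero; suc)
open import Data.Nat.DivMod
  using (_mod_; _%_; m%n<n; m%n%n≡m%n; [m+n]%n≡m%n; %-distribˡ-+; m≡m%n+[m/n]*n; m/n*n≡m;
         m≥n⇒m/n>0)
import Data.Nat.Properties as ℕP
import Data.Nat.Divisibility as ℕD
open import Data.Product using (_×_; _,_; proj₁; proj₂)
open import Data.Rational using (0ℚ; 1ℚ; ½; _+_; _*_; -_; _/_; _≤_; _<_)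
open import Data.Rational.Properties as ℚP
  using (≤-refl; ≤-trans; ≤-reflexive; <⇒≤; <-≤-trans; ≤-<-trans; <-irrefl; <-dense; ≰⇒>;
         _≤?_; +-mono-≤; +-mono-<-≤; ∣p∣≡p∨∣p∣≡-p)
import Data.Rational.Unnormalised as ℚᵘ
import Data.Rational.Unnormalised.Properties as ℚᵘP
open import Data.Sum using (inj₁; inj₂)
open import Data.Vec using (lookup; _[_]≔_)
open import Data.Vec.Properties using (lookup∘update; lookup∘update′; lookup-replicate)
open import Relation.Binary.PropositionalEquality
open import Relation.Nullary using (Dec; yes; no; does; ¬_)
open import Relation.Nullary.Decidable using (dec-true; dec-false)
open import Tactic.RingSolver using (solve-∀)

open ℚ-Lemmas
open ℝ
open ℝ⁺-Lemmas

-- Rational arithmetic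

fromℤ-* : ∀ i j → fromℤ (i ℤ.* j) ≡ fromℤ i * fromℤ j
fromℤ-* i j = ℚP.toℚᵘ-injective (ℚᵘP.≃-trans (toℚᵘ-/ (i ℤ.* j) 0)
  (ℚᵘP.≃-sym (ℚᵘP.≃-trans (ℚP.toℚᵘ-homo-* (fromℤ i) (fromℤ j))
    (ℚᵘP.≃-trans (ℚᵘP.*-cong (toℚᵘ-/ i 0) (toℚᵘ-/ j 0)) (ℚᵘ.*≡* refl)))))

fromℤ-- : ∀ i j → fromℤ (i ℤ.- j) ≡ fromℤ i - fromℤ j
fromℤ-- i j = move (fromℤ (i ℤ.- j)) (fromℤ j)
  (trans (sym (fromℤ-+ (i ℤ.- j) j)) (cong fromℤ (e i j)))
  where
  e : ∀ i j → (i ℤ.- j) ℤ.+ j ≡ i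
  e = ℤSolver.solve-∀
  cancel : ∀ p q → p ≡ (p + q) - q
  cancel = solve-∀ ring
  move : ∀ p q {r} → p + q ≡ r → p ≡ r - q
  move p q h = trans (cancel p q) (cong (_- q) h)

fromℕ-suc : ∀ n → fromℕ (suc n) ≡ 1ℚ + fromℕ n
fromℕ-suc n = fromℤ-+ (+ 1) (+ n)

fromℕ-* : ∀ m n → fromℕ (m ℕ.* n) ≡ fromℕ m * fromℕ n
fromℕ-* m n = trans (cong fromℤ (ℤP.pos-* m n)) (fromℤ-* (+ m) (+ n))

fromℕ-mono : ∀ {m n} → m ℕ.≤ n → fromℕ m ≤ fromℕ n
fromℕ-mono {m} {n} h = /-≤ (+ m) 0 (+ n) 0 (ℤP.*-monoʳ-≤-nonNeg (+ 1) (ℤ.+≤+ h))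

0<fromℕ : ∀ n .{{_ : NonZero n}} → 0ℚ < fromℕ n
0<fromℕ (suc n) = 0<fromℕ-suc n

fromℕ-*-/ : ∀ d i .{{_ : NonZero d}} → fromℕ d * (i / d) ≡ fromℤ i
fromℕ-*-/ (suc d) i = ℚP.toℚᵘ-injective (ℚᵘP.≃-trans
  (ℚP.toℚᵘ-homo-* (fromℕ (suc d)) (i / suc d))
  (ℚᵘP.≃-trans (ℚᵘP.*-cong (toℚᵘ-/ (+ suc d) 0) (toℚᵘ-/ i d))
    (ℚᵘP.≃-trans (ℚᵘ.*≡* (trans (eq (+ suc d) i)
        (cong (λ n → i ℤ.* + suc n) (sym (ℕP.+-identityʳ d)))))
      (ℚᵘP.≃-sym (toℚᵘ-/ i 0)))))
  where
  eq : ∀ d i → (d ℤ.* i) ℤ.* + 1 ≡ i ℤ.* d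
  eq = ℤSolver.solve-∀

∣∣-bound : ∀ {p c} → - c ≤ p → p ≤ c → ∣ p ∣ ≤ c
∣∣-bound {p} {c} lo hi with ∣p∣≡p∨∣p∣≡-p p
... | inj₁ eq = subst (_≤ c) (sym eq) hi
... | inj₂ eq = subst (_≤ c) (sym eq) (subst (- p ≤_) (inv c) (ℚP.neg-antimono-≤ lo))
  where
  inv : ∀ c → - - c ≡ c
  inv = solve-∀ ring

p≤∣p∣ : ∀ p → p ≤ ∣ p ∣
p≤∣p∣ p with ℚP.≤-total 0ℚ p
... | inj₁ 0≤p = ≤-reflexive (sym (ℚP.0≤p⇒∣p∣≡p 0≤p))
... | inj₂ p≤0 = ≤-trans p≤0 (ℚP.0≤∣p∣ p)

-- Rounding to the grid

module _ {υ z z̃} (isNearest : IsNearest υ z z̃) where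
  open IsNearest isNearest
  private
    -- The spacing of the grid.
    g : ℚ
    g = 2^ (ℤ.- υ)
    0<g : 0ℚ < g
    0<g = 0<2^ (ℤ.- υ)

    -- Moving by a multiple of g stays on the grid.
    shift : ∀ i → OnGrid υ (z̃ + fromℤ i * g)
    shift i with on-grid
    ... | n , eq = n ℤ.+ i , trans (distrib (2^ υ) z̃ (fromℤ i) g)
      (trans (cong₂ (λ a b → a + fromℤ i * b) eq (2^-inverse υ))
        (trans (cong (_+_ (fromℤ n)) (ℚP.*-identityʳ (fromℤ i))) (sym (fromℤ-+ n i))))
      where
      distrib : ∀ P z i g → P * (z + i * g) ≡ P * z + i * (P * g)
      distrib = solve-∀ ring

    -- If a step of length g does not bring d closer to 0, then d ≤ g/2.
    not-beyond : ∀ d g → 0ℚ < g → ∣ d ∣ ≤ ∣ d - g ∣ → d ≤ ½ * g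
    not-beyond d g 0<g h with ∣p∣≡p∨∣p∣≡-p (d - g)
    ... | inj₁ eq = ⊥-elim (<-irrefl refl (<-≤-trans (by< 0<g (e d g))
                      (≤-trans (p≤∣p∣ d) (≤-trans h (≤-reflexive eq)))))
      where
      e : ∀ d g → g ≡ d - (d - g)
      e = solve-∀ ring
    ... | inj₂ eq = by≤ (0≤* (<⇒≤ 0<½) (diff≤ (≤-trans (p≤∣p∣ d) (≤-trans h (≤-reflexive eq))))) (e d g)
      where
      e : ∀ d g → ½ * ((- (d - g)) - d) ≡ ½ * g - d
      e = solve-∀ ring

  round-upper : z - z̃ ≤ ½ * g
  round-upper = not-beyond (z - z̃) g 0<g
    (subst (λ w → ∣ z - z̃ ∣ ≤ ∣ w ∣) (e z z̃ g) (nearest _ (shift (+ 1))))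
    where
    e : ∀ z z̃ g → z - (z̃ + 1ℚ * g) ≡ (z - z̃) - g
    e = solve-∀ ring

  round-lower : z̃ - z ≤ ½ * g
  round-lower = not-beyond (z̃ - z) g 0<g
    (subst₂ _≤_ (trans (sym (ℚP.∣-p∣≡∣p∣ (z - z̃))) (cong ∣_∣ (e₁ z z̃)))
                (trans (sym (ℚP.∣-p∣≡∣p∣ _)) (cong ∣_∣ (e₂ z z̃ g))) (nearest _ (shift (ℤ.- + 1))))
    where
    e₁ : ∀ z z̃ → - (z - z̃) ≡ z̃ - z
    e₁ = solve-∀ ring
    e₂ : ∀ z z̃ g → - (z - (z̃ + (- 1ℚ) * g)) ≡ (z̃ - z) - g
    e₂ = solve-∀ ring

  -- Since 0 lies on the grid, a negative value would be farther from z than 0.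
  round-nonneg : 0ℚ ≤ z → 0ℚ ≤ z̃
  round-nonneg 0≤z = by≤ (diff≤ (≤-trans (p≤∣p∣ (z - z̃))
      (≤-trans (nearest 0ℚ (+ 0 , ℚP.*-zeroʳ (2^ υ)))
        (≤-reflexive (trans (cong ∣_∣ (e₀ z)) (ℚP.0≤p⇒∣p∣≡p 0≤z)))))) (e z z̃)
    where
    e₀ : ∀ z → z - 0ℚ ≡ z
    e₀ = solve-∀ ring
    e : ∀ z z̃ → z - (z - z̃) ≡ z̃ - 0ℚ
    e = solve-∀ ring

-- Comparing rational and real numbers

L-fromℚ : ∀ {p c} → p < c → L (fromℚ c) p
L-fromℚ p<c = _ , p<c , ≤-refl

fromℚ-mono : ∀ {p q} x → p ≤ q → fromℚ q ≤ℝ x → fromℚ p ≤ℝ x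
fromℚ-mono x p≤q q≤x (p′ , r<p′ , p′≤p) = q≤x (p′ , r<p′ , ≤-trans p′≤p p≤q)

≤ℝ-intro : ∀ {q} x → (∀ {p} → p < q → L x p) → fromℚ q ≤ℝ x
≤ℝ-intro x h (p′ , p<p′ , p′≤q) = h (<-≤-trans p<p′ p′≤q)

·-mono : ∀ n .{{_ : NonZero n}} {q} x → fromℚ q ≤ℝ x → fromℚ (fromℕ n * q) ≤ℝ n · x
·-mono (suc n-1) {q} x q≤x = ≤ℝ-intro (suc n-1 · x) below
  where
  c = fromℕ (suc n-1)
  below : ∀ {p} → p < c * q → L (suc n-1 · x) p
  below {p} p<cq =
    let m , p<m , m<cq = <-dense p<cq
        r , 0<r , cr≡1 = recip (0<fromℕ-suc n-1)
    in m , p<m , r * m ,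
       q≤x (L-fromℚ (*-cancel-< {c} {r * m} {q} (0<fromℕ-suc n-1)
         (subst (_< c * q) (undo c cr≡1 m) m<cq))) ,
       undo c cr≡1 m

-- If 1/x ≤ a, then κ = 1/a ≤ x.  Were some d < κ above x, then 1/d would be
-- a number that exceeds a but not 1/x.
⁻¹-bound : ∀ (x : ℝ⁺) {a κ} → 0ℚ < a → a * κ ≡ 1ℚ →
           toℝ (x ⁻¹) ≤ℝ fromℚ a → fromℚ κ ≤ℝ toℝ x
⁻¹-bound x⁺@(x , _) {a} {κ} 0<a aκ≡1 h = ≤ℝ-intro x below
  where
  below : ∀ {p} → p < κ → L x p
  below {p} p<κ with <-dense p<κ
  ... | d , p<d , d<κ with located x p<d
  ...   | inj₁ Lp = Lp
  ...   | inj₂ Ud = ⊥-elim (absurd (h (r , a<r , d , Ud , ≤-reflexive (trans (ℚP.*-comm r d) dr≡1))))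
    where
    0<d : 0ℚ < d
    0<d = U⇒0< x⁺ Ud
    r = proj₁ (recip 0<d)
    dr≡1 : d * r ≡ 1ℚ
    dr≡1 = proj₂ (proj₂ (recip 0<d))
    a<r : a < r
    a<r = *-cancel-< {d} {a} {r} 0<d (subst₂ _<_ (ℚP.*-comm a d) (trans aκ≡1 (sym dr≡1))
            (*-monoˡ-< {a} {d} {κ} 0<a d<κ))
    absurd : ¬ L (fromℚ a) a
    absurd (p′ , a<p′ , p′≤a) = <-irrefl refl (<-≤-trans a<p′ p′≤a)

-- κ ≤ 2x - g implies (κ + g)/2 ≤ x.
half-sum-bound : ∀ x {κ} g → fromℚ κ ≤ℝ (2 · x) -ℝ fromℚ g → fromℚ (½ * (κ + g)) ≤ℝ x
half-sum-bound x {κ} g h = ≤ℝ-intro x below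
  where
  e₁ : ∀ p κ g → 2ℚ * (½ * (κ + g) - p) ≡ κ - (2ℚ * p - g)
  e₁ = solve-∀ ring
  e₂ : ∀ p g a b e → ½ * (((a + b) - (2ℚ * p - g)) + ((2ℚ * e - a) + (- b - g))) ≡ e - p
  e₂ = solve-∀ ring
  combine : ∀ {p a b e} → 2ℚ * p - g < a + b → a < 2ℚ * e → g < - b → p < e
  combine {p} {a} {b} {e} h₁ h₂ h₃ =
    by< {p} {e} (0<* 0<½ (0<+ (diff< {2ℚ * p - g} {a + b} h₁)
          (0<+ (diff< {a} {2ℚ * e} h₂) (diff< {g} {(- b)} h₃))))
        (e₂ p g a b e)
  unfold : ∀ {p} → L ((2 · x) -ℝ fromℚ g) (2ℚ * p - g) → L x p
  unfold {p} (_ , p<ab , a , b , (_ , a<2e , e , Le , refl) , (_ , q<-b , g≤q) , refl) =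
    L-down x {p} {e} (combine {p} {a} {b} {e} p<ab a<2e (≤-<-trans g≤q q<-b)) Le
  below : ∀ {p} → p < ½ * (κ + g) → L x p
  below {p} p< = unfold (h (L-fromℚ (by< {2ℚ * p - g} {κ}
    (0<* 0<2 (diff< {p} {½ * (κ + g)} p<)) (e₁ p κ g))))

-- Sums over windows

-- The sum of the first t terms.
prefix : (ℕ → ℚ) → ℕ → ℚ
prefix f zero    = 0ℚ
prefix f (suc t) = prefix f t + f t

-- If x approximates r times the stream within δ, then the sum of the last w terms
-- of x approximates r times that of the stream within w δ.  Truncated subtraction
-- in t ∸ w accounts for the zeros before the beginning.
lastSum-approx : ∀ {R} (s : Stream R) (x : ℕ → ℚ) r δ → 0ℚ ≤ δ →
  (∀ j → ∣ x j - r * fromℕ (toℕ (s j)) ∣ ≤ δ) → ∀ w t →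
  ∣ (prefix x t - prefix x (t ℕ.∸ w)) - r * fromℕ (lastSum s w t) ∣ ≤ fromℕ w * δ
lastSum-approx s x r δ 0≤δ close zero t =
  subst₂ _≤_ (cong ∣_∣ (sym (e₁ (prefix x t) r))) (sym (ℚP.*-zeroˡ δ)) (≤-refl {0ℚ})
  where
  e₁ : ∀ p r → (p - p) - r * 0ℚ ≡ 0ℚ
  e₁ = solve-∀ ring
lastSum-approx s x r δ 0≤δ close (suc w) zero =
  subst (_≤ fromℕ (suc w) * δ) (cong ∣_∣ (sym (e₁ r))) (0≤* {fromℕ (suc w)} {δ} (0≤fromℕ (suc w)) 0≤δ)
  where
  e₁ : ∀ r → (0ℚ - 0ℚ) - r * 0ℚ ≡ 0ℚ
  e₁ = solve-∀ ring
lastSum-approx s x r δ 0≤δ close (suc w) (suc t) =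
  subst₂ _≤_
    (cong ∣_∣ (trans (e₁ r (x t) (fromℕ (toℕ (s t))) P P′ S)
      (cong (λ z → ((P + x t) - P′) - r * z) (sym (fromℤ-+ (+ toℕ (s t)) (+ lastSum s w t))))))
    (trans (e₂ δ (fromℕ w)) (cong (_* δ) (sym (fromℕ-suc w))))
    (≤-trans (ℚP.∣p+q∣≤∣p∣+∣q∣ (x t - r * fromℕ (toℕ (s t))) ((P - P′) - r * S))
      (+-mono-≤ (close t) (lastSum-approx s x r δ 0≤δ close w t)))
  where
  P P′ S : ℚ
  P = prefix x t
  P′ = prefix x (t ℕ.∸ w)
  S = fromℕ (lastSum s w t)
  e₁ : ∀ r a b p p′ s → (a - r * b) + ((p - p′) - r * s) ≡ ((p + a) - p′) - r * (b + s)
  e₁ = solve-∀ ring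
  e₂ : ∀ δ w → δ + w * δ ≡ (1ℚ + w) * δ
  e₂ = solve-∀ ring

-- Residues modulo k

mod-cong : ∀ {a b k} .{{_ : NonZero k}} → a % k ≡ b % k → a mod k ≡ b mod k
mod-cong {a} {b} {k} eq = FinP.toℕ-injective
  (trans (FinP.toℕ-fromℕ< (m%n<n a k)) (trans eq (sym (FinP.toℕ-fromℕ< (m%n<n b k)))))

suc-mod : ∀ q k .{{_ : NonZero k}} → suc (toℕ (q mod k)) mod k ≡ suc q mod k
suc-mod q k = mod-cong (trans (cong (λ r → suc r % k) (FinP.toℕ-fromℕ< (m%n<n q k)))
  (trans (%-distribˡ-+ 1 (q % k) k)
    (trans (cong (λ r → (1 % k ℕ.+ r) % k) (m%n%n≡m%n q k)) (sym (%-distribˡ-+ 1 q k)))))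

mod-distinct : ∀ {q l k} .{{_ : NonZero k}} → q ℕ.< l → l ℕ.< k ℕ.+ q → q mod k ≢ l mod k
mod-distinct {q} {l} {k} q<l l<k+q eq =
  ℕD.>⇒∤ {{ℕ.>-nonZero (ℕP.m<n⇒0<n∸m q<l)}} d<k k∣d
  where
  d<k : l ℕ.∸ q ℕ.< k
  d<k = ℕP.m<n+o⇒m∸n<o l q {{ℕ.>-nonZero (ℕP.≤-<-trans ℕ.z≤n (m%n<n q k))}} (subst (l ℕ.<_) (ℕP.+-comm k q) l<k+q)
  eq% : q % k ≡ l % k
  eq% = trans (sym (FinP.toℕ-fromℕ< (m%n<n q k))) (trans (cong toℕ eq) (FinP.toℕ-fromℕ< (m%n<n l k)))
  k∣d : k ∣ l ℕ.∸ q
  k∣d = ℕD.divides (l ℕ./ k ℕ.∸ q ℕ./ k) (trans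
    (cong₂ ℕ._∸_ (m≡m%n+[m/n]*n l k) (trans (m≡m%n+[m/n]*n q k) (cong (ℕ._+ q ℕ./ k ℕ.* k) eq%)))
    (trans (ℕP.[m+n]∸[m+o]≡n∸o (l % k) (l ℕ./ k ℕ.* k) (q ℕ./ k ℕ.* k))
      (sym (ℕP.*-distribʳ-∸ k (l ℕ./ k) (q ℕ./ k)))))

-- The sequence of carries

-- The carries are determined by a sequence x of numbers in [0, 1] alone, without
-- reference to the states of the algorithm; R and round do not matter here.
module Carry (W k R : ℕ) .{{_ : NonZero k}} .{{_ : NonZero R}} (round : ℚ → ℚ)
             (W≡k*block : W ≡ k ℕ.* (W ℕ./ k)) (0<block : 0 ℕ.< W ℕ./ k)
             (x : ℕ → ℚ) (0≤x : ∀ j → 0ℚ ≤ x j) (x≤1 : ∀ j → x j ≤ 1ℚ) where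
  open Algorithm W k R round

  N : ℚ
  N = fromℕ block

  -- Prefix sums of the sequence that starts with W zeros and continues with x.
  X : ℕ → ℚ
  X t = prefix x (t ℕ.∸ W)

  X-after : ∀ t → X (W ℕ.+ t) ≡ prefix x t
  X-after t = cong (prefix x) (ℕP.m+n∸m≡n W t)

  X-before : ∀ {t} → t ℕ.≤ W → X t ≡ 0ℚ
  X-before h = cong (prefix x) (ℕP.m≤n⇒m∸n≡0 h)

  private
    step : ∀ t → Dec (t ℕ.< W) → X t ≤ X (suc t) × X (suc t) ≤ X t + 1ℚ
    step t (yes t<W) =
      subst₂ (λ p q → p ≤ q × q ≤ p + 1ℚ) (sym (X-before (ℕP.<⇒≤ t<W))) (sym (X-before t<W))
        (≤-refl , <⇒≤ 0<1)
    step t (no t≮W) =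
      subst (λ u → X t ≤ prefix x u × prefix x u ≤ X t + 1ℚ) (sym (ℕP.+-∸-assoc 1 (ℕP.≮⇒≥ t≮W)))
        (add-term (X t) (x (t ℕ.∸ W)) (0≤x (t ℕ.∸ W)) (x≤1 (t ℕ.∸ W)))
      where
      e₁ : ∀ p q → q ≡ (p + q) - p
      e₁ = solve-∀ ring
      add-term : ∀ p q → 0ℚ ≤ q → q ≤ 1ℚ → p ≤ p + q × p + q ≤ p + 1ℚ
      add-term p q 0≤q q≤1 = by≤ 0≤q (e₁ p q) , ℚP.+-monoʳ-≤ p q≤1

  X-step : ∀ t → X t ≤ X (suc t) × X (suc t) ≤ X t + 1ℚ
  X-step t = step t (t ℕ.<? W)

  private
    extend : ∀ {a b c d} → a ≤ b × b ≤ a + d → b ≤ c × c ≤ b + 1ℚ → a ≤ c × c ≤ a + (1ℚ + d)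
    extend {a} {b} {c} {d} (lo , hi) (lo′ , hi′) = ≤-trans lo lo′ ,
      by≤ (+-mono-≤ (diff≤ hi) (diff≤ hi′)) (e₁ a b c d)
      where
      e₁ : ∀ a b c d → ((a + d) - b) + ((b + 1ℚ) - c) ≡ (a + (1ℚ + d)) - c
      e₁ = solve-∀ ring

  X-climb : ∀ d t → X t ≤ X (d ℕ.+ t) × X (d ℕ.+ t) ≤ X t + fromℕ d
  X-climb zero t = ≤-refl , ≤-reflexive (sym (ℚP.+-identityʳ (X t)))
  X-climb (suc d) t = subst (λ e → X t ≤ X (suc d ℕ.+ t) × X (suc d ℕ.+ t) ≤ X t + e)
    (sym (fromℕ-suc d))
    (extend {X t} {X (d ℕ.+ t)} {X (suc d ℕ.+ t)} {fromℕ d} (X-climb d t) (X-step (d ℕ.+ t)))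

  -- C q is the number of carries in the first q blocks of the shifted sequence,
  -- and β q tells whether there is a carry at the end of block q.
  mutual
    C : ℕ → ℤ
    C zero    = + 0
    C (suc q) = C q ℤ.+ bit (β q)

    β : ℕ → Bool
    β q = does (carry? q)

    carry? : ∀ q → Dec (N ≤ X (suc q ℕ.* block) - N * fromℤ (C q))
    carry? q = N ≤? X (suc q ℕ.* block) - N * fromℤ (C q)

  -- The amount pending, that is, not yet carried, at the start of block q.
  Y : ℕ → ℚ
  Y q = X (q ℕ.* block) - N * fromℤ (C q)

  private
    reduce-carry : ∀ n c y → n ≤ y - n * c → y - n * c < n + n →
                   0ℚ ≤ y - n * (c + 1ℚ) × y - n * (c + 1ℚ) < n
    reduce-carry n c y lo hi = by≤ (diff≤ lo) (e₁ n c y) , by< (diff< hi) (e₂ n c y)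
      where
      e₁ : ∀ n c y → (y - n * c) - n ≡ (y - n * (c + 1ℚ)) - 0ℚ
      e₁ = solve-∀ ring
      e₂ : ∀ n c y → (n + n) - (y - n * c) ≡ n - (y - n * (c + 1ℚ))
      e₂ = solve-∀ ring

    grow : ∀ {u v d n z} → u ≤ v × v ≤ u + d → 0ℚ ≤ u - z × u - z < n →
           0ℚ ≤ v - z × v - z < n + d
    grow {u} {v} {d} {n} {z} (u≤v , v≤u+d) (lo , hi) =
      by≤ (+-mono-≤ (diff≤ {u} {v} u≤v) lo) (e₁ u v z) ,
      by< (+-mono-<-≤ (diff< hi) (diff≤ v≤u+d)) (e₂ u v d n z)
      where
      e₁ : ∀ u v z → (v - u) + (u - z) ≡ (v - z) - 0ℚ
      e₁ = solve-∀ ring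
      e₂ : ∀ u v d n z → (n - (u - z)) + ((u + d) - v) ≡ (n + d) - (v - z)
      e₂ = solve-∀ ring

  Y-bounds : ∀ q → 0ℚ ≤ Y q × Y q < N
  Y-bounds zero = subst (λ y → 0ℚ ≤ y × y < N)
    (sym (trans (cong (_- N * 0ℚ) (X-before ℕ.z≤n)) (e₁ N)))
    (≤-refl , 0<fromℕ block {{ℕ.>-nonZero 0<block}})
    where
    e₁ : ∀ n → 0ℚ - n * 0ℚ ≡ 0ℚ
    e₁ = solve-∀ ring
  Y-bounds (suc q) = settle (carry? q)
    where
    f : ℚ
    f = X (suc q ℕ.* block)
    grown : 0ℚ ≤ f - N * fromℤ (C q) × f - N * fromℤ (C q) < N + N
    grown = grow {X (q ℕ.* block)} {f} {N} {N} {N * fromℤ (C q)}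
      (X-climb block (q ℕ.* block)) (Y-bounds q)
    settle : (d : Dec (N ≤ f - N * fromℤ (C q))) →
             0ℚ ≤ f - N * fromℤ (C q ℤ.+ bit (does d)) × f - N * fromℤ (C q ℤ.+ bit (does d)) < N
    settle (yes N≤) = subst (λ c → 0ℚ ≤ f - N * c × f - N * c < N)
      (sym (fromℤ-+ (C q) (+ 1))) (reduce-carry N (fromℤ (C q)) f N≤ (proj₂ grown))
    settle (no N≰) = subst (λ c → 0ℚ ≤ f - N * fromℤ c × f - N * fromℤ c < N)
      (sym (ℤP.+-identityʳ (C q))) (proj₁ grown , ≰⇒> N≰)

  -- At offset m in block q, the pending amount, corrected by m in case of a carry
  -- at the end of this block, is within N/2 of N/2.
  window-bound : ∀ q m → m ℕ.≤ block →
    ∣ ((X (m ℕ.+ q ℕ.* block) - N * fromℤ (C q)) - ½ * N) - fromℕ m * fromℤ (bit (β q)) ∣ ≤ ½ * N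
  window-bound q m m≤block = bound (carry? q)
    where
    a f c M D : ℚ
    a = X (m ℕ.+ q ℕ.* block)
    f = X (suc q ℕ.* block)
    c = N * fromℤ (C q)
    M = fromℕ m
    D = fromℕ (block ℕ.∸ m)
    end : block ℕ.∸ m ℕ.+ (m ℕ.+ q ℕ.* block) ≡ suc q ℕ.* block
    end = trans (sym (ℕP.+-assoc (block ℕ.∸ m) m (q ℕ.* block)))
      (cong (ℕ._+ q ℕ.* block) (ℕP.m∸n+n≡m m≤block))
    M+D : M + D ≡ N
    M+D = trans (sym (fromℤ-+ (+ m) (+ (block ℕ.∸ m)))) (cong fromℕ (ℕP.m+[n∸m]≡n m≤block))
    rest : a ≤ X (block ℕ.∸ m ℕ.+ (m ℕ.+ q ℕ.* block)) ×
           X (block ℕ.∸ m ℕ.+ (m ℕ.+ q ℕ.* block)) ≤ a + D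
    rest = X-climb (block ℕ.∸ m) (m ℕ.+ q ℕ.* block)
    a≤f : a ≤ f
    a≤f = subst (λ u → a ≤ X u) end (proj₁ rest)
    f≤ : f ≤ a + D
    f≤ = subst (λ u → X u ≤ a + D) end (proj₂ rest)
    with-carry : ∀ a f c M D n → M + D ≡ n → n ≤ f - c → f ≤ a + D → a - c < n + M → 
                 ∣ ((a - c) - ½ * n) - M * 1ℚ ∣ ≤ ½ * n
    with-carry a f c M D .(M + D) refl n≤ f≤ a< =
      ∣∣-bound (by≤ (+-mono-≤ (diff≤ n≤) (diff≤ f≤)) (e₁ a f c M D)) (by≤ (<⇒≤ (diff< a<)) (e₂ a c M D))
      where
      e₁ : ∀ a f c M D → ((f - c) - (M + D)) + ((a + D) - f) ≡ (((a - c) - ½ * (M + D)) - M * 1ℚ) - (- (½ * (M + D)))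
      e₁ = solve-∀ ring
      e₂ : ∀ a c M D → ((M + D) + M) - (a - c) ≡ ½ * (M + D) - (((a - c) - ½ * (M + D)) - M * 1ℚ)
      e₂ = solve-∀ ring
    without-carry : ∀ a f c M n → a ≤ f → f - c < n → 0ℚ ≤ a - c →
                 ∣ ((a - c) - ½ * n) - M * 0ℚ ∣ ≤ ½ * n
    without-carry a f c M n a≤f f< 0≤ =
      ∣∣-bound (by≤ 0≤ (e₁ a c M n)) (by≤ (+-mono-≤ (diff≤ a≤f) (<⇒≤ (diff< f<))) (e₂ a f c M n))
      where
      e₁ : ∀ a c M n → a - c ≡ (((a - c) - ½ * n) - M * 0ℚ) - (- (½ * n))
      e₁ = solve-∀ ring
      e₂ : ∀ a f c M n → (f - a) + (n - (f - c)) ≡ ½ * n - (((a - c) - ½ * n) - M * 0ℚ)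
      e₂ = solve-∀ ring
    grown : 0ℚ ≤ a - c × a - c < N + M
    grown = grow {X (q ℕ.* block)} {a} {M} {N} {c} (X-climb m (q ℕ.* block)) (Y-bounds q)
    bound : (d : Dec (N ≤ f - c)) → ∣ ((a - c) - ½ * N) - M * fromℤ (bit (does d)) ∣ ≤ ½ * N
    bound (yes n≤) = with-carry a f c M D N M+D n≤ f≤ (proj₂ grown)
    bound (no n≰) = without-carry a f c M N a≤f (≰⇒> n≰) (proj₁ grown)

  -- There are no carries in the k blocks of zeros.
  mutual
    C-initial : ∀ q → q ℕ.≤ k → C q ≡ + 0
    C-initial zero    _   = refl
    C-initial (suc q) q<k = cong₂ (λ c b → c ℤ.+ bit b) (C-initial q (ℕP.<⇒≤ q<k)) (β-initial q q<k)

    β-initial : ∀ q → q ℕ.< k → β q ≡ false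
    β-initial q q<k = dec-false (carry? q) λ N≤ → <-irrefl refl
      (<-≤-trans (0<fromℕ block {{ℕ.>-nonZero 0<block}}) (subst (N ≤_) nothing N≤))
      where
      e₁ : ∀ n → 0ℚ - n * 0ℚ ≡ 0ℚ
      e₁ = solve-∀ ring
      nothing : X (suc q ℕ.* block) - N * fromℤ (C q) ≡ 0ℚ
      nothing = trans (cong₂ (λ a c → a - N * fromℤ c)
        (X-before (subst (suc q ℕ.* block ℕ.≤_) (sym W≡k*block) (ℕP.*-monoˡ-≤ block q<k)))
        (C-initial q (ℕP.<⇒≤ q<k))) (e₁ N)

-- The invariant of the algorithm

module _ (W k R : ℕ) .{{_ : NonZero k}} .{{_ : NonZero R}} (round : ℚ → ℚ) where
  open Algorithm W k R round

  -- Case distinction on the three branches of Add.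
  add-elim : ∀ {ℓ} (P : State → Set ℓ) st a → let x = round (+ toℕ a / R) in
    (State.m st ≡ block ℕ.∸ 1 → fromℕ block ≤ State.y st + x →
      P (endBlock st true (State.y st - fromℕ block + x))) →
    (State.m st ≡ block ℕ.∸ 1 → ¬ fromℕ block ≤ State.y st + x →
      P (endBlock st false (State.y st + x))) →
    (State.m st ≢ block ℕ.∸ 1 →
      P (record st { y = State.y st + x ; m = suc (State.m st) })) →
    P (add st a)
  add-elim P st a carry no-carry inside
    with State.m st ℕ.≟ block ℕ.∸ 1 | fromℕ block ≤? State.y st + round (+ toℕ a / R)
  ... | yes m≡ | yes N≤ = carry m≡ N≤
  ... | yes m≡ | no N≰  = no-carry m≡ N≰
  ... | no m≢  | _      = inside m≢

-- The algorithm on a stream whose rounded elements x lie in [0, 1].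
module Run (W k R : ℕ) .{{_ : NonZero k}} .{{_ : NonZero R}} (round : ℚ → ℚ)
           (W≡k*block : W ≡ k ℕ.* (W ℕ./ k)) (0<block : 0 ℕ.< W ℕ./ k) (s : Stream R)
           (0≤x : ∀ j → 0ℚ ≤ round (+ toℕ (s j) / R))
           (x≤1 : ∀ j → round (+ toℕ (s j) / R) ≤ 1ℚ) where
  open Algorithm W k R round

  x : ℕ → ℚ
  x j = round (+ toℕ (s j) / R)
  open Carry W k R round W≡k*block 0<block x 0≤x x≤1 public

  -- The state at time t, which is at offset m in block q of the stream.  This is
  -- block k + q of the shifted sequence, and the window starts at offset m in
  -- block q of the shifted sequence.  Position l mod k of the
  -- array holds the bit β l, for l among the last k completed blocks.
  record Invariant (t : ℕ) (st : State) : Set where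
    field
      q       : ℕ
      t≡      : t ≡ State.m st ℕ.+ q ℕ.* block
      m<block : State.m st ℕ.< block
      y≡      : State.y st ≡ prefix x t - N * fromℤ (C (k ℕ.+ q))
      B≡      : State.B st ≡ C (k ℕ.+ q) ℤ.- C q
      i≡      : State.i st ≡ q mod k
      b≡      : ∀ l → q ℕ.≤ l → l ℕ.< k ℕ.+ q → lookup (State.b st) (l mod k) ≡ β l

    bᵢ≡ : State.bᵢ st ≡ β q
    bᵢ≡ = trans (cong (lookup (State.b st)) i≡)
      (b≡ q ℕP.≤-refl (ℕP.m<n+m q (ℕP.≤-<-trans ℕ.z≤n (m%n<n 0 k))))

  initial-invariant : Invariant 0 initial
  initial-invariant = record
    { q       = 0
    ; t≡      = refl
    ; m<block = 0<block
    ; y≡      = sym (trans (cong (λ c → 0ℚ - N * fromℤ c) C≡0) (e₁ N))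
    ; B≡      = sym (trans (ℤP.+-identityʳ (C (k ℕ.+ 0))) C≡0)
    ; i≡      = refl
    ; b≡      = λ l _ l<k → trans (lookup-replicate (l mod k) false)
                  (sym (β-initial l (subst (l ℕ.<_) (ℕP.+-identityʳ k) l<k)))
    }
    where
    e₁ : ∀ n → 0ℚ - n * 0ℚ ≡ 0ℚ
    e₁ = solve-∀ ring
    C≡0 : C (k ℕ.+ 0) ≡ + 0
    C≡0 = C-initial (k ℕ.+ 0) (ℕP.≤-reflexive (ℕP.+-identityʳ k))

  module _ {t : ℕ} {st : State} (inv : Invariant t st) where
    open Invariant inv

    private
      add-y : State.y st + x t ≡ prefix x (suc t) - N * fromℤ (C (k ℕ.+ q))
      add-y = trans (cong (_+ x t) y≡) (e₁ (prefix x t) (N * fromℤ (C (k ℕ.+ q))) (x t))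
        where
        e₁ : ∀ p c a → (p - c) + a ≡ (p + a) - c
        e₁ = solve-∀ ring

    inside-invariant : State.m st ≢ block ℕ.∸ 1 →
      Invariant (suc t) (record st { y = State.y st + x t ; m = suc (State.m st) })
    inside-invariant m≢ = record
      { q = q ; t≡ = cong suc t≡
      ; m<block = ℕP.≤∧≢⇒< m<block (λ eq → m≢ (cong (ℕ._∸ 1) eq))
      ; y≡ = add-y ; B≡ = B≡ ; i≡ = i≡ ; b≡ = b≡ }

    module _ (m≡ : State.m st ≡ block ℕ.∸ 1) where
      private
        suc-t≡ : suc t ≡ suc q ℕ.* block
        suc-t≡ = trans (cong suc t≡) (cong (ℕ._+ q ℕ.* block)
          (trans (cong suc m≡) (ℕP.m+[n∸m]≡n 0<block)))

      -- In the shifted sequence, the block that ends now is block k + q.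
      X-end : X (suc (k ℕ.+ q) ℕ.* block) ≡ prefix x (suc t)
      X-end = trans (cong X (trans position (cong (W ℕ.+_) (sym suc-t≡)))) (X-after (suc t))
        where
        position : suc (k ℕ.+ q) ℕ.* block ≡ W ℕ.+ suc q ℕ.* block
        position = trans (cong (ℕ._* block) (sym (ℕP.+-suc k q)))
          (trans (ℕP.*-distribʳ-+ block k (suc q)) (cong (ℕ._+ suc q ℕ.* block) (sym W≡k*block)))

      -- The algorithm compares N with the same number as the definition of β (k + q).
      pending≡ : X (suc (k ℕ.+ q) ℕ.* block) - N * fromℤ (C (k ℕ.+ q)) ≡ State.y st + x t
      pending≡ = trans (cong (_- N * fromℤ (C (k ℕ.+ q))) X-end) (sym add-y)

      endBlock-invariant : ∀ b y → β (k ℕ.+ q) ≡ b →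
        y ≡ (State.y st + x t) - N * fromℤ (bit b) → Invariant (suc t) (endBlock st b y)
      endBlock-invariant b y β≡ y≡′ = record
        { q       = suc q
        ; t≡      = suc-t≡
        ; m<block = 0<block
        ; y≡      = trans y≡′ (trans (cong (_- N * fromℤ (bit b)) add-y)
            (trans (e₁ (prefix x (suc t)) N (fromℤ (C (k ℕ.+ q))) (fromℤ (bit b)))
              (cong (λ c → prefix x (suc t) - N * c)
                (trans (sym (fromℤ-+ (C (k ℕ.+ q)) (bit b))) (cong fromℤ (sym C-next))))))
        ; B≡      = trans (cong₂ (λ B b′ → (B ℤ.- bit b′) ℤ.+ bit b) B≡ bᵢ≡)
            (trans (e₂ (C (k ℕ.+ q)) (C q) (bit (β q)) (bit b))
              (cong (ℤ._- C (suc q)) (sym C-next)))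
        ; i≡      = trans (cong (λ i → suc (toℕ i) mod k) i≡) (suc-mod q k)
        ; b≡      = bits
        }
        where
        e₁ : ∀ p n c b → (p - n * c) - n * b ≡ p - n * (c + b)
        e₁ = solve-∀ ring
        e₂ : ∀ c c′ b′ b → ((c ℤ.- c′) ℤ.- b′) ℤ.+ b ≡ (c ℤ.+ b) ℤ.- (c′ ℤ.+ b′)
        e₂ = ℤSolver.solve-∀
        C-next : C (k ℕ.+ suc q) ≡ C (k ℕ.+ q) ℤ.+ bit b
        C-next = trans (cong C (ℕP.+-suc k q)) (cong (λ b → C (k ℕ.+ q) ℤ.+ bit b) β≡)
        bits : ∀ l → suc q ℕ.≤ l → l ℕ.< k ℕ.+ suc q →
               lookup (State.b st [ State.i st ]≔ b) (l mod k) ≡ β l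
        bits l q<l l< = stored (l ℕ.≟ k ℕ.+ q)
          where
          stored : Dec (l ≡ k ℕ.+ q) → lookup (State.b st [ State.i st ]≔ b) (l mod k) ≡ β l
          -- The new bit of block k + q replaces that of block q, at the same residue.
          stored (yes l≡) = trans (cong (lookup (State.b st [ State.i st ]≔ b)) same)
            (trans (lookup∘update (State.i st) (State.b st) b) (sym (trans (cong β l≡) β≡)))
            where
            same : l mod k ≡ State.i st
            same = trans (mod-cong (trans (cong (_% k) (trans l≡ (ℕP.+-comm k q))) ([m+n]%n≡m%n q k)))
                     (sym i≡)
          stored (no l≢) = trans (lookup∘update′ other (State.b st) b) (b≡ l (ℕP.<⇒≤ q<l) l<k+q)
            where
            l<k+q : l ℕ.< k ℕ.+ q
            l<k+q = ℕP.≤∧≢⇒< (ℕP.≤-pred (subst (l ℕ.<_) (ℕP.+-suc k q) l<)) l≢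
            other : l mod k ≢ State.i st
            other eq = mod-distinct q<l l<k+q (sym (trans eq i≡))

    add-invariant : Invariant (suc t) (add st (s t))
    add-invariant = add-elim W k R round (Invariant (suc t)) st (s t)
      (λ m≡ N≤ → endBlock-invariant m≡ true (State.y st - N + x t)
        (dec-true (carry? (k ℕ.+ q)) (subst (N ≤_) (sym (pending≡ m≡)) N≤))
        (e₁ (State.y st) N (x t)))
      (λ m≡ N≰ → endBlock-invariant m≡ false (State.y st + x t)
        (dec-false (carry? (k ℕ.+ q)) (λ N≤ → N≰ (subst (N ≤_) (pending≡ m≡) N≤)))
        (e₂ (State.y st + x t) N))
      inside-invariant
      where
      e₁ : ∀ y n a → (y - n) + a ≡ (y + a) - n * 1ℚ
      e₁ = solve-∀ ring
      e₂ : ∀ y n → y ≡ y - n * 0ℚ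
      e₂ = solve-∀ ring

  run-invariant : ∀ t → Invariant t (run s t)
  run-invariant zero    = initial-invariant
  run-invariant (suc t) = add-invariant (run-invariant t)

-- The error of a query

half-block : ∀ W k block .{{_ : NonZero k}} → W ≡ k ℕ.* block →
             (+ W / (2 ℕ.* k)) {{ℕP.m*n≢0 2 k}} ≡ ½ * fromℕ block
half-block W k block W≡ with recip (0<fromℕ k)
... | r , _ , kr≡1 = solve (fromℕ k) r u (fromℕ block) kr≡1
    (trans (cong (_* u) (sym (fromℕ-* 2 k)))
      (trans (fromℕ-*-/ (2 ℕ.* k) (+ W) {{ℕP.m*n≢0 2 k}})
        (trans (cong fromℕ W≡) (fromℕ-* k block))))
  where
  u : ℚ
  u = (+ W / (2 ℕ.* k)) {{ℕP.m*n≢0 2 k}}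
  e₁ : ∀ k r u → (½ * r) * ((2ℚ * k) * u) ≡ (k * r) * u
  e₁ = solve-∀ ring
  e₂ : ∀ k r n → (½ * r) * (k * n) ≡ (k * r) * (½ * n)
  e₂ = solve-∀ ring
  solve : ∀ k r u n → k * r ≡ 1ℚ → (2ℚ * k) * u ≡ k * n → u ≡ ½ * n
  solve k r u n kr≡1 h = trans (sym (unit u kr≡1)) (trans (sym (e₁ k r u))
    (trans (cong (_*_ (½ * r)) h) (trans (e₂ k r n) (unit (½ * n) kr≡1))))

module _ (W k R : ℕ) .{{_ : NonZero k}} .{{_ : NonZero R}} (round : ℚ → ℚ)
         (W≡k*block : W ≡ k ℕ.* (W ℕ./ k)) (0<block : 0 ℕ.< W ℕ./ k) (s : Stream R)
         (υ : ℤ) (isRound : IsRound υ round) where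
  open Algorithm W k R round

  private
    r : ℚ
    r = proj₁ (recip (0<fromℕ R))
    0<r : 0ℚ < r
    0<r = proj₁ (proj₂ (recip (0<fromℕ R)))
    Rr≡1 : fromℕ R * r ≡ 1ℚ
    Rr≡1 = proj₂ (proj₂ (recip (0<fromℕ R)))

    δ : ℚ
    δ = ½ * 2^ (ℤ.- υ)
    0≤δ : 0ℚ ≤ δ
    0≤δ = <⇒≤ (0<* 0<½ (0<2^ (ℤ.- υ)))

    a z : ℕ → ℚ
    a j = fromℕ (toℕ (s j))
    z j = + toℕ (s j) / R

    z≡ : ∀ j → z j ≡ r * a j
    z≡ j = divide (fromℕ R) r (z j) (a j) Rr≡1 (fromℕ-*-/ R (+ toℕ (s j)))
      where
      e₁ : ∀ R r z → (R * r) * z ≡ r * (R * z)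
      e₁ = solve-∀ ring
      divide : ∀ R r z a → R * r ≡ 1ℚ → R * z ≡ a → z ≡ r * a
      divide R r z a h h′ = trans (sym (unit z h)) (trans (e₁ R r z) (cong (_*_ r) h′))

    0≤z : ∀ j → 0ℚ ≤ z j
    0≤z j = subst (0ℚ ≤_) (sym (z≡ j)) (0≤* {r} {a j} (<⇒≤ 0<r) (0≤fromℕ (toℕ (s j))))

    z≤1 : ∀ j → z j ≤ 1ℚ
    z≤1 j = subst₂ _≤_ (sym (z≡ j)) (trans (ℚP.*-comm r (fromℕ R)) Rr≡1)
      (*-monoˡ {r} {a j} {fromℕ R} (<⇒≤ 0<r) (fromℕ-mono (FinP.toℕ≤pred[n] (s j))))

    isNearest : ∀ j → IsNearest υ (z j) (round (z j))
    isNearest j = isRound (z j) (0≤z j) (z≤1 j)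

  open Run W k R round W≡k*block 0<block s
    (λ j → round-nonneg (isNearest j) (0≤z j)) (λ j → IsNearest.z̃≤1 (isNearest j))

  private
    close : ∀ j → ∣ x j - r * a j ∣ ≤ δ
    close j = subst (λ w → ∣ x j - w ∣ ≤ δ) (z≡ j)
      (∣∣-bound (neg {z j} {x j} (round-upper (isNearest j))) (round-lower (isNearest j)))
      where
      e₁ : ∀ z z̃ d → d - (z - z̃) ≡ (z̃ - z) - (- d)
      e₁ = solve-∀ ring
      neg : ∀ {z z̃ d} → z - z̃ ≤ d → - d ≤ z̃ - z
      neg {z} {z̃} {d} h = by≤ (diff≤ h) (e₁ z z̃ d)

  query-error : ∀ t → ∣ query (run s t) - fromℕ (lastSum s W t) ∣
                    ≤ fromℕ R * (½ * N + fromℕ W * δ)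
  query-error t = subst (_≤ fromℕ R * (½ * N + fromℕ W * δ))
    (sym (trans (cong ∣_∣ error≡) (trans (ℚP.∣p*q∣≡∣p∣*∣q∣ (fromℕ R) (E + F))
      (cong (_* ∣ E + F ∣) (ℚP.0≤p⇒∣p∣≡p (0≤fromℕ R))))))
    (*-monoˡ {fromℕ R} {∣ E + F ∣} {½ * N + fromℕ W * δ} (0≤fromℕ R)
      (≤-trans (ℚP.∣p+q∣≤∣p∣+∣q∣ E F) (+-mono-≤ {∣ E ∣} {½ * N} E-bound
        (lastSum-approx s x r δ 0≤δ close W t))))
    where
    st : State
    st = run s t
    open Invariant (run-invariant t)
    -- E is the error from keeping one bit per block, F the one from rounding.
    Cq Ck M β′ S E F : ℚ
    Cq = fromℤ (C q)
    Ck = fromℤ (C (k ℕ.+ q))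
    M = fromℕ (State.m st)
    β′ = fromℤ (bit (β q))
    S = fromℕ (lastSum s W t)
    E = ((X t - N * Cq) - ½ * N) - M * β′
    F = (prefix x t - X t) - r * S
    E-bound : ∣ E ∣ ≤ ½ * N
    E-bound = subst (λ u → ∣ ((X u - N * Cq) - ½ * N) - M * β′ ∣ ≤ ½ * N) (sym t≡)
      (window-bound q (State.m st) (ℕP.<⇒≤ m<block))
    regroup : ∀ R r N Ck Cq P X M b S → R * r ≡ 1ℚ →
      R * (N * (Ck - Cq) + (P - N * Ck) - ½ * N - M * b) - S
      ≡ R * ((((X - N * Cq) - ½ * N) - M * b) + ((P - X) - r * S))
    regroup R r N Ck Cq P X M b S Rr≡1 = trans
      (cong (λ e → R * (N * (Ck - Cq) + (P - N * Ck) - ½ * N - M * b) - e) (sym (unit S Rr≡1)))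
      (e₁ R r N Ck Cq P X M b S)
      where
      e₁ : ∀ R r N Ck Cq P X M b S →
        R * (N * (Ck - Cq) + (P - N * Ck) - ½ * N - M * b) - (R * r) * S
        ≡ R * ((((X - N * Cq) - ½ * N) - M * b) + ((P - X) - r * S))
      e₁ = solve-∀ ring
    -- The value of a query as a function of the four quantities to be rewritten.
    answer : ℚ → ℚ → ℚ → Bool → ℚ
    answer B y u b = fromℕ R * (N * B + y - u - M * fromℤ (bit b))
    query≡ : query st ≡ answer (Ck - Cq) (prefix x t - N * Ck) (½ * N) (β q)
    query≡ = trans (cong₂ (λ B y → answer B y _ (State.bᵢ st))
        (trans (cong fromℤ B≡) (fromℤ-- (C (k ℕ.+ q)) (C q))) y≡)
      (cong₂ (answer (Ck - Cq) (prefix x t - N * Ck)) (half-block W k block W≡k*block) bᵢ≡)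
    error≡ : query st - S ≡ fromℕ R * (E + F)
    error≡ = trans (cong (_- S) query≡)
      (regroup (fromℕ R) r N Ck Cq (prefix x t) (X t) M β′ S Rr≡1)

theorem15 : (W R k : ℕ) .{{_ : NonZero W}} .{{_ : NonTrivial W}} .{{_ : NonZero R}} .{{_ : NonZero k}} →
    (ε : ℝ⁺) →
    toℝ (ε ⁻¹) ≤ℝ 2 · W · (1ℝ -ℝ toℝ (log⁺ W ⁻¹)) →
    (υ : ℤ) → (υ-def : ⌈ log (ε ⁻¹ *⁺ log⁺ W) ⌉≡ υ) →
    ⌈ toℝ (denominator W ε υ υ-def ⁻¹) ⌉≡ (+ k) →
    k ∣ W →
    (round : ℚ → ℚ) → IsRound υ round →
    (s : Stream R) → (t : ℕ) →
    let open Algorithm W k R round in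
    fromℚ (∣ query (run s t) - fromℕ (lastSum s W t) ∣) ≤ℝ R · W · toℝ ε
theorem15 W R k ε _ υ υ-def (_ , inverse≤k) k∣W round isRound s t =
  fromℚ-mono (R · W · toℝ ε)
    (≤-trans (query-error W k R round W≡k*block 0<block s υ isRound t)
      (≤-reflexive (rescale (fromℕ R) (fromℕ W) (fromℕ k) (fromℕ block) κ g kκ≡1
        (trans (cong fromℕ W≡k*block) (fromℕ-* k block)))))
    (·-mono R (W · toℝ ε) (·-mono W (toℝ ε)
      (half-sum-bound (toℝ ε) g (⁻¹-bound (denominator W ε υ υ-def) (0<fromℕ k) kκ≡1 inverse≤k))))
  where
  block : ℕ
  block = W ℕ./ k
  W≡k*block : W ≡ k ℕ.* block
  W≡k*block = trans (sym (m/n*n≡m k∣W)) (ℕP.*-comm block k)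
  0<block : 0 ℕ.< block
  0<block = m≥n⇒m/n>0 {W} {k} (ℕD.∣⇒≤ k∣W)
  g κ : ℚ
  g = 2^ (ℤ.- υ)
  κ = proj₁ (recip (0<fromℕ k))
  kκ≡1 : fromℕ k * κ ≡ 1ℚ
  kκ≡1 = proj₂ (proj₂ (recip (0<fromℕ k)))
  e₁ : ∀ R k n κ g → R * (½ * ((k * κ) * n) + (k * n) * (½ * g)) ≡ R * ((k * n) * (½ * (κ + g)))
  e₁ = solve-∀ ring
  rescale : ∀ R W k n κ g → k * κ ≡ 1ℚ → W ≡ k * n →
            R * (½ * n + W * (½ * g)) ≡ R * (W * (½ * (κ + g)))
  rescale R W k n κ g kκ≡1 refl = trans
    (cong (λ m → R * (½ * m + (k * n) * (½ * g))) (sym (unit n kκ≡1))) (e₁ R k n κ g)
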